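{- Let $e_1,\dots,e_k\in\mathbb{C}^{n\times n}$ be an anticommuting family, $n\ge 1$. Then \[\sum_{i=1}^k \mathrm{rk}(e_i^n)\le (2\log_2 n+1)\,n.\]
   Context: A family $e_1,\dots,e_k$ of complex $n\times n$ matrices is called anticommuting if $e_ie_j=-e_je_i$ for all distinct $i,j\in\{1,\dots,k\}$. $\mathrm{rk}$ denotes matrix rank. -}

module Defs where

open import Algebra.Bundles.Raw using (RawRing)
import Algebra.Definitions.RawMonoid as RawMonoidDefs
open import Data.Bool.Base using (if_then_else_)
open import Data.Fin.Base using (Fin)
import Data.Fin.Properties as Fin
open import Data.Integer.Base as ℤ using (+_)
import Data.Integer.Properties as ℤ
open import Data.Nat.Base as ℕ using (ℕ; zero; suc; NonZero; s≤s; z≤n)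
open import Data.Nat.Logarithm using (⌊log₂_⌋; ⌊log₂⌋-mono-≤; ⌊log₂[2^n]⌋≡n; ⌊log₂⌊n/2⌋⌋≡⌊log₂n⌋∸1)
import Data.Nat.Induction as ℕ
import Data.Nat.Properties as ℕ
open import Data.Product.Base using (∃-syntax; _×_; _,_)
open import Data.Rational.Base as ℚ using (ℚ; mkℚ; 0ℚ; 1ℚ; ½; ∣_∣; Positive)
import Data.Rational.Properties as ℚ
open import Data.Rational.Solver using (module +-*-Solver)
open import Data.Rational.Unnormalised.Base as ℚᵘ using (mkℚᵘ)
import Data.Rational.Unnormalised.Properties as ℚᵘ
open import Data.Sum.Base using (inj₁; inj₂)
open import Data.Vec.Functional using (Vector; transpose)
open import Level using (0ℓ; _⊔_)
open import Relation.Binary.PropositionalEquality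
  using (_≡_; _≢_; refl; sym; trans; cong; cong₂; subst)
open import Relation.Nullary.Decidable.Core using (does)

private
  variable
    n k : ℕ

IsCauchy : (ℕ → ℚ) → Set
IsCauchy x = ∀ ε → 0ℚ ℚ.< ε →
  ∃[ N ] ∀ i j → N ℕ.≤ i → N ℕ.≤ j → ∣ x i ℚ.- x j ∣ ℚ.< ε

record ℝ : Set where
  constructor mkℝ
  field
    seq    : ℕ → ℚ
    cauchy : IsCauchy seq

open ℝ public

infix 4 _≈ℝ_ _≤ℝ_

record _≈ℝ_ (x y : ℝ) : Set where
  constructor mk≈
  field
    eventually-close : ∀ ε → 0ℚ ℚ.< ε →
      ∃[ N ] ∀ i → N ℕ.≤ i → ∣ seq x i ℚ.- seq y i ∣ ℚ.< ε

record _≤ℝ_ (x y : ℝ) : Set where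
  constructor mk≤
  field
    eventually-below : ∀ ε → 0ℚ ℚ.< ε →
      ∃[ N ] ∀ i → N ℕ.≤ i → seq x i ℚ.< seq y i ℚ.+ ε

open _≈ℝ_ public
open _≤ℝ_ public

private
  half-pos : ∀ {ε} → 0ℚ ℚ.< ε → 0ℚ ℚ.< ½ ℚ.* ε
  half-pos {ε} 0<ε = subst (ℚ._< ½ ℚ.* ε) (ℚ.*-zeroʳ ½) (ℚ.*-monoʳ-<-pos ½ 0<ε)

  half+half : ∀ ε → ½ ℚ.* ε ℚ.+ ½ ℚ.* ε ≡ ε
  half+half ε = trans (sym (ℚ.*-distribʳ-+ ε ½ ½)) (ℚ.*-identityˡ ε)

  split : ∀ a b → a ≡ b ℚ.+ (a ℚ.- b)
  split = solve 2 (λ a b → a := b :+ (a :- b)) refl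
    where open +-*-Solver

  cancel : ∀ a b → a ℚ.+ b ℚ.- a ≡ b
  cancel = solve 2 (λ a b → a :+ b :- a := b) refl
    where open +-*-Solver

  neg-diff : ∀ a b → ℚ.- (a ℚ.- b) ≡ b ℚ.- a
  neg-diff = solve 2 (λ a b → :- (a :- b) := b :- a) refl
    where open +-*-Solver

  +-diff : ∀ a b c d → (a ℚ.+ b) ℚ.- (c ℚ.+ d) ≡ (a ℚ.- c) ℚ.+ (b ℚ.- d)
  +-diff = solve 4 (λ a b c d → (a :+ b) :- (c :+ d) := (a :- c) :+ (b :- d)) refl
    where open +-*-Solver

  *-diff : ∀ a b c d → a ℚ.* b ℚ.- c ℚ.* d ≡ d ℚ.* (a ℚ.- c) ℚ.+ a ℚ.* (b ℚ.- d)
  *-diff = solve 4 (λ a b c d → a :* b :- c :* d := d :* (a :- c) :+ a :* (b :- d)) refl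
    where open +-*-Solver

  ∣x-x∣≡0 : ∀ x → ∣ x ℚ.- x ∣ ≡ 0ℚ
  ∣x-x∣≡0 x = cong ∣_∣ (ℚ.+-inverseʳ x)

  const-cauchy : ∀ q → IsCauchy (λ _ → q)
  const-cauchy q ε 0<ε = 0 , λ _ _ _ _ → subst (ℚ._< ε) (sym (∣x-x∣≡0 q)) 0<ε

  neg-cauchy : ∀ {x} → IsCauchy x → IsCauchy (λ i → ℚ.- x i)
  neg-cauchy {x} cx ε 0<ε with cx ε 0<ε
  ... | N , p = N , λ i j N≤i N≤j → subst (ℚ._< ε) (sym (eq (x i) (x j))) (p i j N≤i N≤j)
    where
    eq : ∀ a b → ∣ ℚ.- a ℚ.- (ℚ.- b) ∣ ≡ ∣ a ℚ.- b ∣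
    eq a b = trans (cong ∣_∣ (sym (ℚ.neg-distrib-+ a (ℚ.- b)))) (ℚ.∣-p∣≡∣p∣ (a ℚ.- b))

  +-cauchy : ∀ {x y} → IsCauchy x → IsCauchy y → IsCauchy (λ i → x i ℚ.+ y i)
  +-cauchy {x} {y} cx cy ε 0<ε with cx (½ ℚ.* ε) (half-pos 0<ε) | cy (½ ℚ.* ε) (half-pos 0<ε)
  ... | M , p | N , q = M ℕ.⊔ N , λ i j le le′ → bound i j
      (p i j (ℕ.m⊔n≤o⇒m≤o M N le) (ℕ.m⊔n≤o⇒m≤o M N le′))
      (q i j (ℕ.m⊔n≤o⇒n≤o M N le) (ℕ.m⊔n≤o⇒n≤o M N le′))
    where
    open ℚ.≤-Reasoning
    bound : ∀ i j → ∣ x i ℚ.- x j ∣ ℚ.< ½ ℚ.* ε → ∣ y i ℚ.- y j ∣ ℚ.< ½ ℚ.* ε →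
            ∣ (x i ℚ.+ y i) ℚ.- (x j ℚ.+ y j) ∣ ℚ.< ε
    bound i j u v = begin-strict
      ∣ (x i ℚ.+ y i) ℚ.- (x j ℚ.+ y j) ∣
        ≡⟨ cong ∣_∣ (+-diff (x i) (y i) (x j) (y j)) ⟩
      ∣ (x i ℚ.- x j) ℚ.+ (y i ℚ.- y j) ∣
        ≤⟨ ℚ.∣p+q∣≤∣p∣+∣q∣ (x i ℚ.- x j) (y i ℚ.- y j) ⟩
      ∣ x i ℚ.- x j ∣ ℚ.+ ∣ y i ℚ.- y j ∣
        <⟨ ℚ.+-mono-< u v ⟩
      ½ ℚ.* ε ℚ.+ ½ ℚ.* ε
        ≡⟨ half+half ε ⟩
      ε ∎

  cauchy-bounded : ∀ {x} → IsCauchy x →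
    ∃[ B ] Positive B × ∃[ N ] ∀ i → N ℕ.≤ i → ∣ x i ∣ ℚ.≤ B
  cauchy-bounded {x} cx with cx 1ℚ (ℚ.positive⁻¹ 1ℚ)
  ... | N , p = ∣ x N ∣ ℚ.+ 1ℚ
      , ℚ.nonNeg+pos⇒pos ∣ x N ∣ {{ℚ.∣-∣-nonNeg (x N)}} 1ℚ
      , N , λ i N≤i → ℚ.<⇒≤ (bound i (p i N N≤i ℕ.≤-refl))
    where
    open ℚ.≤-Reasoning
    bound : ∀ i → ∣ x i ℚ.- x N ∣ ℚ.< 1ℚ → ∣ x i ∣ ℚ.< ∣ x N ∣ ℚ.+ 1ℚ
    bound i u = begin-strict
      ∣ x i ∣
        ≡⟨ cong ∣_∣ (split (x i) (x N)) ⟩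
      ∣ x N ℚ.+ (x i ℚ.- x N) ∣
        ≤⟨ ℚ.∣p+q∣≤∣p∣+∣q∣ (x N) (x i ℚ.- x N) ⟩
      ∣ x N ∣ ℚ.+ ∣ x i ℚ.- x N ∣
        <⟨ ℚ.+-monoʳ-< ∣ x N ∣ u ⟩
      ∣ x N ∣ ℚ.+ 1ℚ ∎

  div-pos : ∀ B → Positive B → ∀ {ε} → 0ℚ ℚ.< ε → ∃[ δ ] 0ℚ ℚ.< δ × B ℚ.* δ ≡ ε
  div-pos B posB {ε} 0<ε = ℚ.1/ B ℚ.* ε , pos , eq
    where
    instance
      _ = posB
      _ = ℚ.pos⇒nonZero B
      _ = ℚ.1/pos⇒pos B
    pos : 0ℚ ℚ.< ℚ.1/ B ℚ.* ε
    pos = subst (ℚ._< ℚ.1/ B ℚ.* ε) (ℚ.*-zeroʳ (ℚ.1/ B)) (ℚ.*-monoʳ-<-pos (ℚ.1/ B) 0<ε)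
    eq : B ℚ.* (ℚ.1/ B ℚ.* ε) ≡ ε
    eq = trans (sym (ℚ.*-assoc B (ℚ.1/ B) ε))
        (trans (cong (ℚ._* ε) (ℚ.*-inverseʳ B)) (ℚ.*-identityˡ ε))

  ∣*∣-bound : ∀ {B} → Positive B → ∀ u v {γ} →
    ∣ u ∣ ℚ.≤ B → ∣ v ∣ ℚ.< γ → ∣ u ℚ.* v ∣ ℚ.< B ℚ.* γ
  ∣*∣-bound {B} posB u v {γ} u≤B v<γ = begin-strict
    ∣ u ℚ.* v ∣       ≡⟨ ℚ.∣p*q∣≡∣p∣*∣q∣ u v ⟩
    ∣ u ∣ ℚ.* ∣ v ∣   ≤⟨ ℚ.*-monoʳ-≤-nonNeg ∣ v ∣ {{ℚ.∣-∣-nonNeg v}} u≤B ⟩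
    B ℚ.* ∣ v ∣       <⟨ ℚ.*-monoʳ-<-pos B {{posB}} v<γ ⟩
    B ℚ.* γ           ∎
    where open ℚ.≤-Reasoning

  ∣*-*∣-bound : ∀ {B C} → Positive B → Positive C → ∀ a b c d {δ η} →
    ∣ a ∣ ℚ.≤ B → ∣ d ∣ ℚ.≤ C → ∣ a ℚ.- c ∣ ℚ.< δ → ∣ b ℚ.- d ∣ ℚ.< η →
    ∣ a ℚ.* b ℚ.- c ℚ.* d ∣ ℚ.< C ℚ.* δ ℚ.+ B ℚ.* η
  ∣*-*∣-bound {B} {C} posB posC a b c d {δ} {η} a≤B d≤C u v = begin-strict
    ∣ a ℚ.* b ℚ.- c ℚ.* d ∣
      ≡⟨ cong ∣_∣ (*-diff a b c d) ⟩
    ∣ d ℚ.* (a ℚ.- c) ℚ.+ a ℚ.* (b ℚ.- d) ∣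
      ≤⟨ ℚ.∣p+q∣≤∣p∣+∣q∣ (d ℚ.* (a ℚ.- c)) (a ℚ.* (b ℚ.- d)) ⟩
    ∣ d ℚ.* (a ℚ.- c) ∣ ℚ.+ ∣ a ℚ.* (b ℚ.- d) ∣
      <⟨ ℚ.+-mono-< (∣*∣-bound posC d (a ℚ.- c) d≤C u) (∣*∣-bound posB a (b ℚ.- d) a≤B v) ⟩
    C ℚ.* δ ℚ.+ B ℚ.* η ∎
    where open ℚ.≤-Reasoning

  *-cauchy : ∀ {x y} → IsCauchy x → IsCauchy y → IsCauchy (λ i → x i ℚ.* y i)
  *-cauchy {x} {y} cx cy ε 0<ε =
    let B , posB , N₁ , b = cauchy-bounded cx
        C , posC , N₂ , c = cauchy-bounded cy
        δ , 0<δ , Cδ≡ = div-pos C posC (half-pos 0<ε)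
        η , 0<η , Bη≡ = div-pos B posB (half-pos 0<ε)
        N₃ , p = cx δ 0<δ
        N₄ , q = cy η 0<η
        fst : ∀ {o} → _ → _ ℕ.≤ o
        fst = ℕ.m⊔n≤o⇒m≤o (N₁ ℕ.⊔ N₂) (N₃ ℕ.⊔ N₄)
        snd : ∀ {o} → _ → _ ℕ.≤ o
        snd = ℕ.m⊔n≤o⇒n≤o (N₁ ℕ.⊔ N₂) (N₃ ℕ.⊔ N₄)
    in (N₁ ℕ.⊔ N₂) ℕ.⊔ (N₃ ℕ.⊔ N₄) , λ i j le le′ →
      subst (∣ x i ℚ.* y i ℚ.- x j ℚ.* y j ∣ ℚ.<_)
        (trans (cong₂ ℚ._+_ Cδ≡ Bη≡) (half+half ε))
        (∣*-*∣-bound posB posC (x i) (y i) (x j) (y j)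
          (b i (ℕ.m⊔n≤o⇒m≤o N₁ N₂ (fst le)))
          (c j (ℕ.m⊔n≤o⇒n≤o N₁ N₂ (fst le′)))
          (p i j (ℕ.m⊔n≤o⇒m≤o N₃ N₄ (snd le)) (ℕ.m⊔n≤o⇒m≤o N₃ N₄ (snd le′)))
          (q i j (ℕ.m⊔n≤o⇒n≤o N₃ N₄ (snd le)) (ℕ.m⊔n≤o⇒n≤o N₃ N₄ (snd le′))))

infixl 6 _+ℝ_
infixl 7 _*ℝ_
infix  8 -ℝ_

_+ℝ_ : ℝ → ℝ → ℝ
x +ℝ y = mkℝ (λ i → seq x i ℚ.+ seq y i) (+-cauchy {seq x} {seq y} (cauchy x) (cauchy y))

_*ℝ_ : ℝ → ℝ → ℝ
x *ℝ y = mkℝ (λ i → seq x i ℚ.* seq y i) (*-cauchy {seq x} {seq y} (cauchy x) (cauchy y))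

-ℝ_ : ℝ → ℝ
-ℝ x = mkℝ (λ i → ℚ.- seq x i) (neg-cauchy {seq x} (cauchy x))

fromℚ : ℚ → ℝ
fromℚ q = mkℝ (λ _ → q) (const-cauchy q)

fromℕ : ℕ → ℝ
fromℕ m = fromℚ (+ m ℚ./ 1)

private
  <2^1+⌊log₂⌋ : ∀ m → m ℕ.< 2 ℕ.^ suc ⌊log₂ m ⌋
  <2^1+⌊log₂⌋ m = ℕ.≰⇒> λ le → ℕ.1+n≰n
    (subst (ℕ._≤ ⌊log₂ m ⌋) (⌊log₂[2^n]⌋≡n (suc ⌊log₂ m ⌋)) (⌊log₂⌋-mono-≤ le))

  2^⌊log₂⌋≤ : ∀ m .{{_ : NonZero m}} → 2 ℕ.^ ⌊log₂ m ⌋ ℕ.≤ m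
  2^⌊log₂⌋≤ m = ℕ.<-rec P step m
    where
    open ℕ.≤-Reasoning
    P : ℕ → Set
    P m = .{{_ : NonZero m}} → 2 ℕ.^ ⌊log₂ m ⌋ ℕ.≤ m
    step : ∀ m → (∀ {l} → l ℕ.< m → P l) → P m
    step 1 _ = s≤s z≤n
    step m@(suc (suc l)) rec = begin
      2 ℕ.^ ⌊log₂ m ⌋
        ≤⟨ ℕ.^-monoʳ-≤ 2 (ℕ.m≤n+m∸n ⌊log₂ m ⌋ 1) ⟩
      2 ℕ.* 2 ℕ.^ (⌊log₂ m ⌋ ℕ.∸ 1)
        ≡⟨ cong (λ a → 2 ℕ.* 2 ℕ.^ a) (⌊log₂⌊n/2⌋⌋≡⌊log₂n⌋∸1 m) ⟨
      2 ℕ.* 2 ℕ.^ ⌊log₂ ℕ.⌊ m /2⌋ ⌋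
        ≤⟨ ℕ.*-monoʳ-≤ 2 (rec (ℕ.⌊n/2⌋<n (suc l))) ⟩
      2 ℕ.* ℕ.⌊ m /2⌋
        ≡⟨ cong (ℕ.⌊ m /2⌋ ℕ.+_) (ℕ.+-identityʳ ℕ.⌊ m /2⌋) ⟩
      ℕ.⌊ m /2⌋ ℕ.+ ℕ.⌊ m /2⌋
        ≤⟨ ℕ.+-monoʳ-≤ ℕ.⌊ m /2⌋ (ℕ.⌊n/2⌋≤⌈n/2⌉ m) ⟩
      ℕ.⌊ m /2⌋ ℕ.+ ℕ.⌈ m /2⌉
        ≡⟨ ℕ.⌊n/2⌋+⌈n/2⌉≡n m ⟩
      m ∎

-- With L the exact logarithm of n, ⌊log₂ nᵐ⌋ = ⌊m L⌋, so the m-th term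
-- lies in (L − 1/m , L].  Indices are shifted by one to have m ≥ 1.
log₂-seq : ℕ → ℕ → ℚ
log₂-seq n i = + ⌊log₂ (n ℕ.^ suc i) ⌋ ℚ./ suc i

private
  ^-cancelʳ-< : ∀ {a b} → 2 ℕ.^ a ℕ.< 2 ℕ.^ b → a ℕ.< b
  ^-cancelʳ-< 2ᵃ<2ᵇ = ℕ.≰⇒> λ b≤a → ℕ.<⇒≱ 2ᵃ<2ᵇ (ℕ.^-monoʳ-≤ 2 b≤a)

  log-cross : ∀ n .{{_ : NonZero n}} i j .{{_ : NonZero i}} →
    ⌊log₂ (n ℕ.^ i) ⌋ ℕ.* j ℕ.< suc ⌊log₂ (n ℕ.^ j) ⌋ ℕ.* i
  log-cross n i j = ^-cancelʳ-< (begin-strict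
    2 ℕ.^ (a ℕ.* j)      ≡⟨ ℕ.^-*-assoc 2 a j ⟨
    (2 ℕ.^ a) ℕ.^ j      ≤⟨ ℕ.^-monoˡ-≤ j (2^⌊log₂⌋≤ (n ℕ.^ i) {{ℕ.m^n≢0 n i}}) ⟩
    (n ℕ.^ i) ℕ.^ j      ≡⟨ ℕ.^-*-assoc n i j ⟩
    n ℕ.^ (i ℕ.* j)      ≡⟨ cong (n ℕ.^_) (ℕ.*-comm i j) ⟩
    n ℕ.^ (j ℕ.* i)      ≡⟨ ℕ.^-*-assoc n j i ⟨
    (n ℕ.^ j) ℕ.^ i      <⟨ ℕ.^-monoˡ-< i (<2^1+⌊log₂⌋ (n ℕ.^ j)) ⟩
    (2 ℕ.^ suc b) ℕ.^ i  ≡⟨ ℕ.^-*-assoc 2 (suc b) i ⟩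
    2 ℕ.^ (suc b ℕ.* i)  ∎)
    where
    open ℕ.≤-Reasoning
    a = ⌊log₂ (n ℕ.^ i) ⌋
    b = ⌊log₂ (n ℕ.^ j) ⌋

  /-<-+ : ∀ a b m l → a ℕ.* suc l ℕ.< suc b ℕ.* suc m →
          + a ℚ./ suc m ℚ.< + b ℚ./ suc l ℚ.+ + 1 ℚ./ suc l
  /-<-+ a b m l lt = ℚ.toℚᵘ-cancel-< (begin-strict
    ℚ.toℚᵘ (+ a ℚ./ suc m)
      ≃⟨ ℚ.toℚᵘ-fromℚᵘ (mkℚᵘ (+ a) m) ⟩
    mkℚᵘ (+ a) m
      <⟨ ℚᵘ.*<* (ℤ.≤-<-trans (ℤ.≤-reflexive (sym (ℤ.pos-* a (suc l))))
                 (ℤ.<-≤-trans (ℤ.+<+ lt) (ℤ.≤-reflexive (ℤ.pos-* (suc b) (suc m))))) ⟩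
    mkℚᵘ (+ suc b) l
      ≃⟨ ℚᵘ.*≡* eq ⟩
    mkℚᵘ (+ b) l ℚᵘ.+ mkℚᵘ (+ 1) l
      ≃⟨ ℚᵘ.+-cong (ℚ.toℚᵘ-fromℚᵘ (mkℚᵘ (+ b) l)) (ℚ.toℚᵘ-fromℚᵘ (mkℚᵘ (+ 1) l)) ⟨
    ℚ.toℚᵘ (+ b ℚ./ suc l) ℚᵘ.+ ℚ.toℚᵘ (+ 1 ℚ./ suc l)
      ≃⟨ ℚ.toℚᵘ-homo-+ (+ b ℚ./ suc l) (+ 1 ℚ./ suc l) ⟨
    ℚ.toℚᵘ (+ b ℚ./ suc l ℚ.+ + 1 ℚ./ suc l) ∎)
    where
    open ℚᵘ.≤-Reasoning
    eq : + suc b ℤ.* (+ suc l ℤ.* + suc l) ≡ (+ b ℤ.* + suc l ℤ.+ + 1 ℤ.* + suc l) ℤ.* + suc l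
    eq = trans (sym (ℤ.*-assoc (+ suc b) (+ suc l) (+ suc l)))
      (cong (ℤ._* + suc l) (trans (cong (ℤ._* + suc l) (ℤ.+-comm (+ 1) (+ b)))
        (ℤ.*-distribʳ-+ (+ suc l) (+ b) (+ 1))))

  1/-≤ : ∀ ε → 0ℚ ℚ.< ε → ∃[ N ] ∀ l → N ℕ.≤ l → + 1 ℚ./ suc l ℚ.≤ ε
  1/-≤ (mkℚ (+ zero)      d _) (ℚ.*<* (ℤ.+<+ ()))
  1/-≤ (mkℚ ℤ.-[1+ _ ]    d _) (ℚ.*<* ())
  1/-≤ ε@(mkℚ (+ suc p) d _) _ = d , λ l d≤l → ℚ.toℚᵘ-cancel-≤
    (ℚᵘ.≤-respˡ-≃ (ℚᵘ.≃-sym (ℚ.toℚᵘ-fromℚᵘ (mkℚᵘ (+ 1) l)))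
      (ℚᵘ.*≤* (ℤ.≤-trans (ℤ.≤-reflexive (sym (ℤ.pos-* 1 (suc d))))
        (ℤ.≤-trans (ℤ.+≤+ (ℕ.*-mono-≤ (s≤s (z≤n {p})) (s≤s d≤l)))
          (ℤ.≤-reflexive (ℤ.pos-* (suc p) (suc l)))))))

  <+⇒-< : ∀ p q {ε} → p ℚ.< q ℚ.+ ε → p ℚ.- q ℚ.< ε
  <+⇒-< p q {ε} lt = subst (p ℚ.- q ℚ.<_)
    (cancel q ε)
    (ℚ.+-monoˡ-< (ℚ.- q) lt)

  ∣-∣<-intro : ∀ p q {ε} → p ℚ.< q ℚ.+ ε → q ℚ.< p ℚ.+ ε → ∣ p ℚ.- q ∣ ℚ.< ε
  ∣-∣<-intro p q p<q+ε q<p+ε with ℚ.∣p∣≡p∨∣p∣≡-p (p ℚ.- q)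
  ... | inj₁ eq = subst (ℚ._< _) (sym eq) (<+⇒-< p q p<q+ε)
  ... | inj₂ eq = subst (ℚ._< _) (sym (trans eq
      (neg-diff p q))) (<+⇒-< q p q<p+ε)

  log₂-cauchy : ∀ n .{{_ : NonZero n}} → IsCauchy (log₂-seq n)
  log₂-cauchy n ε 0<ε with 1/-≤ ε 0<ε
  ... | N , 1/≤ε = N , λ i j N≤i N≤j →
      ∣-∣<-intro (log₂-seq n i) (log₂-seq n j) (below i j N≤j) (below j i N≤i)
    where
    below : ∀ i j → N ℕ.≤ j → log₂-seq n i ℚ.< log₂-seq n j ℚ.+ ε
    below i j N≤j = ℚ.<-≤-trans
      (/-<-+ ⌊log₂ (n ℕ.^ suc i) ⌋ ⌊log₂ (n ℕ.^ suc j) ⌋ i j (log-cross n (suc i) (suc j)))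
      (ℚ.+-monoʳ-≤ (log₂-seq n j) (1/≤ε j N≤j))

log₂ : (n : ℕ) .{{_ : NonZero n}} → ℝ
log₂ n = mkℝ (log₂-seq n) (log₂-cauchy n)

record ℂ : Set where
  constructor _+i_
  field
    re im : ℝ

open ℂ public

infix 4 _≈ℂ_

record _≈ℂ_ (z w : ℂ) : Set where
  constructor _,ℂ_
  field
    re≈ : re z ≈ℝ re w
    im≈ : im z ≈ℝ im w

open _≈ℂ_ public

ℂ-rawRing : RawRing 0ℓ 0ℓ
ℂ-rawRing = record
  { Carrier = ℂ
  ; _≈_     = _≈ℂ_
  ; _+_     = λ z w → (re z +ℝ re w) +i (im z +ℝ im w)
  ; _*_     = λ z w → (re z *ℝ re w +ℝ -ℝ (im z *ℝ im w)) +i (re z *ℝ im w +ℝ im z *ℝ re w)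
  ; -_      = λ z → (-ℝ re z) +i (-ℝ im z)
  ; 0#      = fromℕ 0 +i fromℕ 0
  ; 1#      = fromℕ 1 +i fromℕ 0
  }

module Matrices {c ℓ} (R : RawRing c ℓ) where

  open RawRing R
  open RawMonoidDefs +-rawMonoid using (sum)

  Matrix : ℕ → Set c
  Matrix n = Vector (Vector Carrier n) n

  infix  4 _≈ᴹ_
  infixl 7 _*ᴹ_
  infix  8 -ᴹ_
  infixr 8 _^ᴹ_

  _≈ᴹ_ : Matrix n → Matrix n → Set ℓ
  A ≈ᴹ B = ∀ i j → A i j ≈ B i j

  _*ᴹ_ : Matrix n → Matrix n → Matrix n
  (A *ᴹ B) i j = sum λ l → A i l * B l j

  -ᴹ_ : Matrix n → Matrix n
  (-ᴹ A) i j = - A i j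

  1ᴹ : Matrix n
  1ᴹ i j = if does (i Fin.≟ j) then 1# else 0#

  _^ᴹ_ : Matrix n → ℕ → Matrix n
  A ^ᴹ zero  = 1ᴹ
  A ^ᴹ suc m = A *ᴹ A ^ᴹ m

  Anticommuting : Vector (Matrix n) k → Set ℓ
  Anticommuting e = ∀ i j → i ≢ j → e i *ᴹ e j ≈ᴹ -ᴹ (e j *ᴹ e i)

  LinearlyIndependent : Vector (Vector Carrier n) k → Set (c ⊔ ℓ)
  LinearlyIndependent {k = k} v = (a : Vector Carrier k) →
    (∀ i → sum (λ j → a j * v j i) ≈ 0#) → ∀ j → a j ≈ 0#

  -- The columns of A selected by s.  A selection with a repetition is
  -- never linearly independent (over a nontrivial ring), so s need not be
  -- required to be injective.
  columns : Matrix n → Vector (Fin n) k → Vector (Vector Carrier n) k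
  columns A s j = transpose A (s j)

  -- The rank as the maximal number of linearly independent columns.  It is
  -- a relation because equality in R need not be decidable: it is
  -- single-valued, but over ℂ its totality holds only up to ¬¬.
  IsRank : Matrix n → ℕ → Set (c ⊔ ℓ)
  IsRank {n} A r =
    (∃[ s ] LinearlyIndependent {k = r} (columns A s)) ×
    (∀ m (s : Vector (Fin n) m) → LinearlyIndependent (columns A s) → m ℕ.≤ r)

{-# OPTIONS --safe #-}

-- The inequality says that 2 ^ Σ rk (eᵢⁿ) ≤ (2 n²)ⁿ.  This is decidable, so it
-- may be proved under a double negation, where ℂ behaves like a discrete field.
-- The kernel of eᵢ is invariant under every eⱼ, because eᵢ eⱼ v = − eⱼ eᵢ v.  If
-- it is neither 0 nor the whole space, the family is block triangular in an
-- adapted basis, with blocks of sizes d + r = n, and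
-- rk (eⱼᵈ⁺ʳ) ≤ rk (aᵈ) + rk (bʳ) for the diagonal blocks a, b of eⱼ; induct.
-- Otherwise every eᵢ is 0 or injective.  For m + 1 injective anticommuting
-- matrices, the 2 ^ m ordered products of distinct members among m of them are
-- linearly independent in the n²-dimensional space of matrices, so
-- 2 ^ (m + 1) ≤ 2 n².

module Submission where

open import Defs
open import Algebra.Bundles using (CommutativeRing)
open import Algebra.Bundles.Raw using (RawRing)
import Algebra.Consequences.Setoid as Consequences
import Algebra.Solver.Ring.NaturalCoefficients.Default as NaturalCoefficients
open import Data.Fin.Base as Fin using (Fin; zero; suc; _↑ˡ_; _↑ʳ_; splitAt)
import Data.Fin.Properties as Fin
open import Data.Integer.Base as ℤ using (+_; -[1+_])
import Data.Integer.Properties as ℤ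
open import Data.Nat.Base as ℕ using (ℕ; zero; suc; z≤n; s≤s; NonZero; +-0-rawMonoid)
open import Data.Nat.Induction using (<-rec)
open import Data.Nat.Logarithm using (⌊log₂_⌋; ⌊log₂⌋-mono-≤; ⌊log₂[2^n]⌋≡n)
import Data.Nat.Properties as ℕ
open import Data.Nat.Solver using () renaming (module +-*-Solver to ℕ-Solver)
open import Data.Product.Base using (∃-syntax; Σ-syntax; _×_; _,_)
open import Data.Rational.Base as ℚ using (ℚ; 0ℚ; 1ℚ; ½; ∣_∣; Positive)
import Data.Rational.Properties as ℚ
open import Data.Rational.Solver using (module +-*-Solver)
open import Data.Rational.Unnormalised.Base as ℚᵘ using (mkℚᵘ)
import Data.Rational.Unnormalised.Properties as ℚᵘ
open import Data.Sum.Base using (_⊎_; inj₁; inj₂; [_,_])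
open import Data.Vec.Functional using (Vector; tail; _∷_; _++_)
import Data.Vec.Functional.Relation.Binary.Equality.Setoid as VectorEquality
open import Effect.Applicative using (RawApplicative)
open import Effect.Monad using (RawMonad)
open import Function.Base using (_∘_)
open import Level using (0ℓ; _⊔_)
open import Relation.Binary.Bundles using (Setoid)
open import Relation.Binary.Structures using (IsEquivalence)
open import Relation.Binary.PropositionalEquality as ≡ using (_≡_; _≢_)
import Relation.Binary.Reasoning.Setoid as SetoidReasoning
open import Relation.Nullary.Decidable using (yes; no; _×-dec_; ¬¬-excluded-middle; decidable-stable)
open import Relation.Nullary.Negation using (¬_; contradiction; ¬¬-Monad)

-- The power is what makes ranks subadditive along blocks. A block triangular matrix can have larger
-- rank than its diagonal blocks together, as a nilpotent one shows; the exponent `n = d + r` spends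
-- `d` steps on one block and `r` on the other, so each block meets the induction hypothesis with
-- its own size as exponent. One injective matrix has to be kept out of the products: the product of
-- the three Pauli matrices is a scalar, so the products of all members can be dependent. The matrix
-- kept out supplies, for each generator, an operator that anticommutes with it and commutes with
-- the later ones. It costs the factor 2 in `2 n²`, which becomes the summand 1 in `2 log₂ n + 1`.
-- Intermediate ranks are never computed; they are bounded through factorizations over smaller
-- spaces.

infixl 1 _>>=_

-- `A` and `B` may live in different universes: splittings of vector spaces are bound into
-- conclusions about naturals.
_>>=_ : ∀ {a b} {A : Set a} {B : Set b} → ¬ ¬ A → (A → ¬ ¬ B) → ¬ ¬ B
(¬¬a >>= f) ¬b = ¬¬a λ a → f a ¬b

return : ∀ {a} {A : Set a} → A → ¬ ¬ A
return a ¬a = ¬a a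

∀-split : ∀ {p m n} {P : Fin (m ℕ.+ n) → Set p} →
  (∀ i → P (i ↑ˡ n)) → (∀ j → P (m ↑ʳ j)) → ∀ k → P k
∀-split {m = zero}  l r k       = r k
∀-split {m = suc m} l r zero    = l zero
∀-split {m = suc m} {P = P} l r (suc k) = ∀-split {P = P ∘ suc} (l ∘ suc) r k

¬¬-applicative : ∀ {a} → RawApplicative {a} (λ A → ¬ ¬ A)
¬¬-applicative = RawMonad.rawApplicative ¬¬-Monad

-- Finite sums and the numerical bound

open import Algebra.Definitions.RawMonoid ℕ.+-0-rawMonoid using () renaming (sum to sumℕ)

sumℕ-mono : ∀ {k} {f g : Fin k → ℕ} → (∀ i → f i ℕ.≤ g i) → sumℕ f ℕ.≤ sumℕ g
sumℕ-mono {zero}  f≤g = z≤n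
sumℕ-mono {suc k} f≤g = ℕ.+-mono-≤ (f≤g zero) (sumℕ-mono (f≤g ∘ suc))

-- Collects the indices of the second case, so that the sum becomes a count times `n`. Injectivity
-- of `s` keeps the chosen members distinct, as anticommutation requires.
selected : ∀ {p k n} {P : Fin k → Set p} (r : Fin k → ℕ) → (∀ i → r i ≡ 0 ⊎ (r i ≡ n × P i)) →
  ∃[ m ] Σ[ s ∈ (Fin m → Fin k) ] (∀ {i j} → s i ≡ s j → i ≡ j) × (∀ i → P (s i)) × sumℕ r ≡ m ℕ.* n
selected {k = zero}  r cases = 0 , (λ ()) , (λ { {()} }) , (λ ()) , ≡.refl
selected {k = suc k} r cases with cases zero | selected (r ∘ suc) (cases ∘ suc)
... | inj₁ r₀≡0       | m , s , s-inj , Ps , sum≡ =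
  m , suc ∘ s , s-inj ∘ Fin.suc-injective , Ps , ≡.cong₂ ℕ._+_ r₀≡0 sum≡
... | inj₂ (r₀≡n , P₀) | m , s , s-inj , Ps , sum≡ =
  suc m , s′ , s′-inj , (λ { zero → P₀ ; (suc i) → Ps i }) , ≡.cong₂ ℕ._+_ r₀≡n sum≡
  where
  s′ : Fin (suc m) → Fin (suc k)
  s′ = zero ∷ (suc ∘ s)
  s′-inj : ∀ {i j} → s′ i ≡ s′ j → i ≡ j
  s′-inj {zero}  {zero}  _  = ≡.refl
  s′-inj {zero}  {suc _} ()
  s′-inj {suc _} {zero}  ()
  s′-inj {suc i} {suc j} eq = ≡.cong suc (s-inj (Fin.suc-injective eq))

-- Each base only grows when replaced by that of the whole size, and then the exponents add. A bound
-- of this shape survives the gluing of two diagonal blocks.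
bounds-superadditive : ∀ a b s t →
  2 ℕ.^ s ℕ.≤ (2 ℕ.* (a ℕ.* a)) ℕ.^ a → 2 ℕ.^ t ℕ.≤ (2 ℕ.* (b ℕ.* b)) ℕ.^ b →
  2 ℕ.^ (s ℕ.+ t) ℕ.≤ (2 ℕ.* ((a ℕ.+ b) ℕ.* (a ℕ.+ b))) ℕ.^ (a ℕ.+ b)
bounds-superadditive a b s t 2^s≤ 2^t≤ = begin
  2 ℕ.^ (s ℕ.+ t)                             ≡⟨ ℕ.^-distribˡ-+-* 2 s t ⟩
  2 ℕ.^ s ℕ.* 2 ℕ.^ t                         ≤⟨ ℕ.*-mono-≤ 2^s≤ 2^t≤ ⟩
  C a ℕ.^ a ℕ.* C b ℕ.^ b                     ≤⟨ ℕ.*-mono-≤ (ℕ.^-monoˡ-≤ a (C-mono a (ℕ.m≤m+n a b)))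
                                                             (ℕ.^-monoˡ-≤ b (C-mono b (ℕ.m≤n+m b a))) ⟩
  C (a ℕ.+ b) ℕ.^ a ℕ.* C (a ℕ.+ b) ℕ.^ b     ≡⟨ ℕ.^-distribˡ-+-* (C (a ℕ.+ b)) a b ⟨
  C (a ℕ.+ b) ℕ.^ (a ℕ.+ b)                   ∎
  where
  open ℕ.≤-Reasoning
  C : ℕ → ℕ
  C m = 2 ℕ.* (m ℕ.* m)
  C-mono : ∀ m {m′} → m ℕ.≤ m′ → C m ℕ.≤ C m′
  C-mono m m≤m′ = ℕ.*-monoʳ-≤ 2 (ℕ.*-mono-≤ m≤m′ m≤m′)

-- A record rather than a function of R, and stated with the operations of
-- Matrices R itself: two instances are then compared through R only, and the
-- Cauchy proofs inside the operations of ℂ are not unfolded.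
record RankBound {c ℓ} (R : RawRing c ℓ) : Set (c ⊔ ℓ) where
  field
    2^∑rk≤ : ∀ n k (e : Vector (Matrices.Matrix R n) k) → Matrices.Anticommuting R e →
      (rk : Fin k → ℕ) → (∀ i → Matrices.IsRank R (Matrices._^ᴹ_ R (e i) n) (rk i)) →
      2 ℕ.^ sumℕ rk ℕ.≤ (2 ℕ.* (n ℕ.* n)) ℕ.^ n

-- The conditions allow a field without decidable equality, such as ℂ.
record IsClassicalField {c ℓ} (K : CommutativeRing c ℓ) : Set (c ⊔ ℓ) where
  open CommutativeRing K
  field
    ≈0-stable  : ∀ x → ¬ ¬ (x ≈ 0#) → x ≈ 0#
    ≈0-or-unit : ∀ x → ¬ ¬ (x ≈ 0# ⊎ ∃[ y ] y * x ≈ 1#)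
    1≉0        : ¬ (1# ≈ 0#)
    x+x≈0⇒x≈0  : ∀ x → x + x ≈ 0# → x ≈ 0#

module LinearAlgebra {c ℓ} (K : CommutativeRing c ℓ) (K-field : IsClassicalField K) where

  open CommutativeRing K hiding (zero)
  open IsClassicalField K-field
  open VectorEquality setoid
  open import Algebra.Properties.Semiring.Sum semiring
    using (sum; sum-cong-≋; sum-replicate-zero; ∑-comm; *-distribˡ-sum; *-distribʳ-sum)
    renaming (∑-distrib-+ to K-∑-distrib-+)
  open import Algebra.Properties.CommutativeMonoid.Sum ℕ.+-0-commutativeMonoid using (∑-distrib-+)
  open import Algebra.Properties.Ring ring using (-0#≈0#; -‿distribˡ-*; -1*x≈-x; -‿involutive)
  open import Algebra.Properties.CommutativeSemigroup *-commutativeSemigroup using (x∙yz≈y∙xz)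
  open NaturalCoefficients commutativeSemiring using (solve; _:+_; _:*_; _:=_; con)
  open SetoidReasoning setoid

  x≈0⇒y+x≈y : ∀ {x y} → x ≈ 0# → y + x ≈ y
  x≈0⇒y+x≈y x≈0 = trans (+-congˡ x≈0) (+-identityʳ _)

  x≈0⇒x+y≈y : ∀ {x y} → x ≈ 0# → x + y ≈ y
  x≈0⇒x+y≈y x≈0 = trans (+-congʳ x≈0) (+-identityˡ _)

  x≈0⇒xy≈0 : ∀ {x y} → x ≈ 0# → x * y ≈ 0#
  x≈0⇒xy≈0 x≈0 = trans (*-congʳ x≈0) (zeroˡ _)

  y≈0⇒xy≈0 : ∀ {x y} → y ≈ 0# → x * y ≈ 0#
  y≈0⇒xy≈0 y≈0 = trans (*-congˡ y≈0) (zeroʳ _)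

  private
    variable
      d k m n p q r : ℕ

  -- Linear maps between coordinate spaces

  V : ℕ → Set c
  V = Vector Carrier

  infixl 6 _⊕_
  infixr 7 _·_
  infix  8 ⊖_

  _⊕_ : V n → V n → V n
  (u ⊕ v) i = u i + v i

  _·_ : Carrier → V n → V n
  (a · v) i = a * v i

  ⊖_ : V n → V n
  (⊖ v) i = - v i

  𝟘 : V n
  𝟘 _ = 0#

  infixr 1 _⊸_
  infixr 9 _∘ˡ_
  infixl 6 _+ˡ_

  record _⊸_ (m n : ℕ) : Set (c ⊔ ℓ) where
    field
      app    : V m → V n
      cong   : ∀ {u v} → u ≋ v → app u ≋ app v
      +-homo : ∀ u v → app (u ⊕ v) ≋ app u ⊕ app v
      ·-homo : ∀ a v → app (a · v) ≋ a · app v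

    0-homo : ∀ {v} → v ≋ 𝟘 → app v ≋ 𝟘
    0-homo {v} v≋𝟘 i = begin
      app v i          ≈⟨ cong (λ j → trans (v≋𝟘 j) (sym (zeroˡ (v j)))) i ⟩
      app (0# · v) i   ≈⟨ ·-homo 0# v i ⟩
      0# * app v i     ≈⟨ zeroˡ _ ⟩
      0#               ∎

    ⊖-homo : ∀ v → app (⊖ v) ≋ ⊖ app v
    ⊖-homo v i = begin
      app (⊖ v) i            ≈⟨ cong (λ j → sym (-1*x≈-x (v j))) i ⟩
      app ((- 1#) · v) i     ≈⟨ ·-homo (- 1#) v i ⟩
      - 1# * app v i         ≈⟨ -1*x≈-x _ ⟩
      - app v i              ∎

  open _⊸_ public

  idˡ : n ⊸ n
  idˡ = record { app = λ v → v ; cong = λ u≋v → u≋v ; +-homo = λ _ _ _ → refl ; ·-homo = λ _ _ _ → refl }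

  _∘ˡ_ : n ⊸ p → m ⊸ n → m ⊸ p
  f ∘ˡ g = record
    { app    = app f ∘ app g
    ; cong   = cong f ∘ cong g
    ; +-homo = λ u v → ≋-trans (cong f (+-homo g u v)) (+-homo f _ _)
    ; ·-homo = λ a v → ≋-trans (cong f (·-homo g a v)) (·-homo f a _)
    }

  _+ˡ_ : m ⊸ n → m ⊸ n → m ⊸ n
  f +ˡ g = record
    { app    = λ v → app f v ⊕ app g v
    ; cong   = λ u≋v i → +-cong (cong f u≋v i) (cong g u≋v i)
    ; +-homo = λ u v i → trans (+-cong (+-homo f u v i) (+-homo g u v i)) (interchange _ _ _ _)
    ; ·-homo = λ a v i → trans (+-cong (·-homo f a v i) (·-homo g a v i)) (sym (distribˡ a _ _))
    }
    where
    interchange : ∀ a b c d → (a + b) + (c + d) ≈ (a + c) + (b + d)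
    interchange = solve 4 (λ a b c d → (a :+ b) :+ (c :+ d) := (a :+ c) :+ (b :+ d)) refl

  reindex : (Fin m → Fin n) → n ⊸ m
  reindex s = record
    { app = λ v → v ∘ s ; cong = λ u≋v → u≋v ∘ s ; +-homo = λ _ _ _ → refl ; ·-homo = λ _ _ _ → refl }

  tailˡ : suc n ⊸ n
  tailˡ = reindex suc

  headˡ : V n → suc m ⊸ n
  headˡ w = record
    { app    = λ v → v zero · w
    ; cong   = λ u≋v _ → *-congʳ (u≋v zero)
    ; +-homo = λ _ _ _ → distribʳ _ _ _
    ; ·-homo = λ _ _ _ → *-assoc _ _ _
    }

  shift : n ⊸ suc n
  shift = record
    { app    = 0# ∷_
    ; cong   = λ { u≋v zero → refl ; u≋v (suc i) → u≋v i }
    ; +-homo = λ { _ _ zero → sym (+-identityˡ 0#) ; _ _ (suc _) → refl }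
    ; ·-homo = λ { a _ zero → sym (zeroʳ a) ; _ _ (suc _) → refl }
    }

  prepend-head : suc m ⊸ n → suc m ⊸ suc n
  prepend-head f = record
    { app    = λ v → v zero ∷ app f v
    ; cong   = λ { u≋v zero → u≋v zero ; u≋v (suc i) → cong f u≋v i }
    ; +-homo = λ { _ _ zero → refl ; u v (suc i) → +-homo f u v i }
    ; ·-homo = λ { _ _ zero → refl ; a v (suc i) → ·-homo f a v i }
    }

  pair : m ⊸ n → m ⊸ p → m ⊸ n ℕ.+ p
  pair {n = n} f g = record
    { app    = λ v → app f v ++ app g v
    ; cong   = λ u≋v i → on (splitAt n i) (cong f u≋v) (cong g u≋v)
    ; +-homo = λ u v i → on₊ u v (splitAt n i)
    ; ·-homo = λ a v i → on· a v (splitAt n i)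
    }
    where
    on : ∀ {u u′ : V n} {v v′} (s : Fin n ⊎ Fin _) → u ≋ u′ → v ≋ v′ → [ u , v ] s ≈ [ u′ , v′ ] s
    on (inj₁ i) p q = p i
    on (inj₂ i) p q = q i
    on₊ : ∀ u v s → [ app f (u ⊕ v) , app g (u ⊕ v) ] s ≈ [ app f u , app g u ] s + [ app f v , app g v ] s
    on₊ u v (inj₁ i) = +-homo f u v i
    on₊ u v (inj₂ i) = +-homo g u v i
    on· : ∀ a v s → [ app f (a · v) , app g (a · v) ] s ≈ a * [ app f v , app g v ] s
    on· a v (inj₁ i) = ·-homo f a v i
    on· a v (inj₂ i) = ·-homo g a v i

  copair : n ⊸ m → p ⊸ m → n ℕ.+ p ⊸ m
  copair {n = n} {p = p} f g = f ∘ˡ reindex (_↑ˡ p) +ˡ g ∘ˡ reindex (n ↑ʳ_)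

  copair-pair : ∀ (f : n ⊸ m) (g : p ⊸ m) (f′ : q ⊸ n) (g′ : q ⊸ p) v →
    app (copair f g) (app (pair f′ g′) v) ≋ app f (app f′ v) ⊕ app g (app g′ v)
  copair-pair {n = n} {p = p} f g f′ g′ v i = +-cong
    (cong f (λ j → reflexive (≡.cong [ app f′ v , app g′ v ] (Fin.splitAt-↑ˡ n j p))) i)
    (cong g (λ j → reflexive (≡.cong [ app f′ v , app g′ v ] (Fin.splitAt-↑ʳ n p j))) i)

  Injective : m ⊸ n → Set (c ⊔ ℓ)
  Injective f = ∀ v → app f v ≋ 𝟘 → v ≋ 𝟘

  -- Kernels, complements and dimension

  -- Coordinates adapted to the kernel: `ι₁` embeds the kernel, `ι₂` a complement, and `π₁`, `π₂`
  -- read off the two components. That the complement meets the kernel only in 0 is expressed by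
  -- injectivity of `A ∘ˡ ι₂`.
  record KernelSplit (A : q ⊸ p) : Set (c ⊔ ℓ) where
    field
      {dimKernel dimImage} : ℕ
      dim-sum : dimKernel ℕ.+ dimImage ≡ q
      ι₁ : dimKernel ⊸ q
      ι₂ : dimImage ⊸ q
      π₁ : q ⊸ dimKernel
      π₂ : q ⊸ dimImage
      recombine    : ∀ v → app ι₁ (app π₁ v) ⊕ app ι₂ (app π₂ v) ≋ v
      ι₁-injective : Injective ι₁
      kernel       : ∀ v → app A (app ι₁ v) ≋ 𝟘
      A∘ι₂-injective : Injective (A ∘ˡ ι₂)

    -- `A` sees only the `ι₂` component. Hence the image of `ι₁` is the whole kernel, which is what
    -- makes kernel-preserving operators block triangular.
    π₂-kernel : ∀ v → app A v ≋ 𝟘 → app π₂ v ≋ 𝟘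
    π₂-kernel v Av≋𝟘 = A∘ι₂-injective _ λ i → begin
      app A (app ι₂ (app π₂ v)) i
        ≈⟨ x≈0⇒x+y≈y (kernel (app π₁ v) i) ⟨
      app A (app ι₁ (app π₁ v)) i + app A (app ι₂ (app π₂ v)) i
        ≈⟨ +-homo A _ _ i ⟨
      app A (app ι₁ (app π₁ v) ⊕ app ι₂ (app π₂ v)) i
        ≈⟨ cong A (recombine v) i ⟩
      app A v i
        ≈⟨ Av≋𝟘 i ⟩
      0# ∎

  open KernelSplit

  -- `S` splits the restriction of `A` to vectors with first coordinate 0. Here the new column
  -- depends on the old ones, and `1# ∷ app (ι₂ S) y` becomes a new basis vector of the kernel.
  enlarge-kernel : (A : suc q ⊸ p) (S : KernelSplit (A ∘ˡ shift)) →
    ∀ y → app A (1# ∷ app (ι₂ S) y) ≋ 𝟘 → KernelSplit A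
  enlarge-kernel A S y Ay≋𝟘 = record
    { dim-sum        = ≡.cong suc (dim-sum S)
    ; ι₁             = prepend-head (headˡ (app (ι₂ S) y) +ˡ ι₁ S ∘ˡ tailˡ)
    ; ι₂             = shift ∘ˡ ι₂ S
    ; π₁             = prepend-head (π₁ S ∘ˡ tailˡ)
    -- The new kernel vector, taken `v zero` times, brings along a multiple of `ι₂ y`; the first
    -- term removes it again.
    ; π₂             = headˡ ((- 1#) · y) +ˡ π₂ S ∘ˡ tailˡ
    ; recombine      = λ { v zero → +-identityʳ _ ; v (suc i) → recombine′ v i }
    ; ι₁-injective   = λ v ιv≋𝟘 → λ
      { zero    → ιv≋𝟘 zero
      ; (suc i) → ι₁-injective S (tail v)
          (λ j → trans (sym (x≈0⇒x+y≈y (x≈0⇒xy≈0 (ιv≋𝟘 zero)))) (ιv≋𝟘 (suc j))) i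
      }
    ; kernel         = kernel′
    ; A∘ι₂-injective = A∘ι₂-injective S
    }
    where
    rearranged : ∀ c i a m w → (c * i + a) + (c * (m * i) + w) ≈ (c * i) * (1# + m) + (a + w)
    rearranged = solve 5 (λ c i a m w →
      (c :* i :+ a) :+ (c :* (m :* i) :+ w) := (c :* i) :* (con 1 :+ m) :+ (a :+ w)) refl

    recombine′ : ∀ v i → _ ≈ _
    recombine′ v i = begin
      (v zero * app (ι₂ S) y i + app (ι₁ S) (app (π₁ S) (tail v)) i)
        + app (ι₂ S) (v zero · (- 1#) · y ⊕ app (π₂ S) (tail v)) i
        ≈⟨ +-congˡ (trans (+-homo (ι₂ S) _ _ i)
             (+-congʳ (trans (·-homo (ι₂ S) _ _ i) (*-congˡ (·-homo (ι₂ S) _ _ i))))) ⟩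
      (v zero * app (ι₂ S) y i + app (ι₁ S) (app (π₁ S) (tail v)) i)
        + (v zero * (- 1# * app (ι₂ S) y i) + app (ι₂ S) (app (π₂ S) (tail v)) i)
        ≈⟨ rearranged _ _ _ _ _ ⟩
      (v zero * app (ι₂ S) y i) * (1# + - 1#)
        + (app (ι₁ S) (app (π₁ S) (tail v)) i + app (ι₂ S) (app (π₂ S) (tail v)) i)
        ≈⟨ x≈0⇒x+y≈y (y≈0⇒xy≈0 (-‿inverseʳ 1#)) ⟩
      app (ι₁ S) (app (π₁ S) (tail v)) i + app (ι₂ S) (app (π₂ S) (tail v)) i
        ≈⟨ recombine S (tail v) i ⟩
      v (suc i) ∎

    kernel′ : ∀ v → app A (v zero ∷ (v zero · app (ι₂ S) y ⊕ app (ι₁ S) (tail v))) ≋ 𝟘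
    kernel′ v i = begin
      app A (v zero ∷ (v zero · app (ι₂ S) y ⊕ app (ι₁ S) (tail v))) i
        ≈⟨ cong A (λ { zero → sym (trans (+-identityʳ _) (*-identityʳ _)) ; (suc _) → refl }) i ⟩
      app A (v zero · (1# ∷ app (ι₂ S) y) ⊕ (0# ∷ app (ι₁ S) (tail v))) i
        ≈⟨ trans (+-homo A _ _ i) (+-congʳ (·-homo A _ _ i)) ⟩
      v zero * app A (1# ∷ app (ι₂ S) y) i + app A (0# ∷ app (ι₁ S) (tail v)) i
        ≈⟨ +-cong (y≈0⇒xy≈0 (Ay≋𝟘 i)) (kernel S (tail v) i) ⟩
      0# + 0#
        ≈⟨ +-identityˡ 0# ⟩
      0# ∎

  -- Here the new column is independent of the old ones, and the first unit vector joins the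
  -- complement.
  enlarge-image : (A : suc q ⊸ p) (S : KernelSplit (A ∘ˡ shift)) →
    ¬ (∃[ y ] app A (1# ∷ app (ι₂ S) y) ≋ 𝟘) → KernelSplit A
  enlarge-image A S e₀∉image = record
    { dim-sum        = ≡.trans (ℕ.+-suc _ _) (≡.cong suc (dim-sum S))
    ; ι₁             = shift ∘ˡ ι₁ S
    ; ι₂             = prepend-head (ι₂ S ∘ˡ tailˡ)
    ; π₁             = π₁ S ∘ˡ tailˡ
    ; π₂             = prepend-head (π₂ S ∘ˡ tailˡ)
    ; recombine      = λ { v zero → +-identityˡ _ ; v (suc i) → recombine S (tail v) i }
    ; ι₁-injective   = λ v ιv≋𝟘 → ι₁-injective S v (ιv≋𝟘 ∘ suc)
    ; kernel         = kernel S
    ; A∘ι₂-injective = injective′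
    }
    where
    injective′ : ∀ v → app A (v zero ∷ app (ι₂ S) (tail v)) ≋ 𝟘 → v ≋ 𝟘
    injective′ v Av≋𝟘 = λ { zero → v₀≈0 ; (suc i) → A∘ι₂-injective S (tail v) A0v≋𝟘 i }
      where
      v₀-nonunit : ¬ (∃[ y ] y * v zero ≈ 1#)
      -- Dividing by an invertible first coordinate would produce a kernel vector of the excluded
      -- form.
      v₀-nonunit (y , yv₀≈1) = e₀∉image (y · tail v , λ i → begin
        app A (1# ∷ app (ι₂ S) (y · tail v)) i
          ≈⟨ cong A (λ { zero → sym yv₀≈1 ; (suc j) → ·-homo (ι₂ S) y (tail v) j }) i ⟩
        app A (y · (v zero ∷ app (ι₂ S) (tail v))) i
          ≈⟨ ·-homo A y _ i ⟩
        y * app A (v zero ∷ app (ι₂ S) (tail v)) i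
          ≈⟨ y≈0⇒xy≈0 (Av≋𝟘 i) ⟩
        0# ∎)

      v₀≈0 : v zero ≈ 0#
      v₀≈0 = ≈0-stable _ (≈0-or-unit (v zero) >>= [ return , (λ unit → contradiction unit v₀-nonunit) ])

      A0v≋𝟘 : app A (0# ∷ app (ι₂ S) (tail v)) ≋ 𝟘
      A0v≋𝟘 i = trans (cong A (λ { zero → sym v₀≈0 ; (suc _) → refl }) i) (Av≋𝟘 i)

  -- Gaussian elimination, one column at a time. Whether a column depends on the others is
  -- undecidable, hence the double negation.
  kernelSplit : (A : q ⊸ p) → ¬ ¬ KernelSplit A
  kernelSplit {zero} A = return record
    { dimKernel = 0 ; dim-sum = ≡.refl ; ι₁ = idˡ ; ι₂ = idˡ ; π₁ = idˡ ; π₂ = idˡ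
    ; recombine = λ _ () ; ι₁-injective = λ _ _ () ; kernel = λ _ → 0-homo A λ () ; A∘ι₂-injective = λ _ _ () }
  kernelSplit {suc q} A =
    kernelSplit (A ∘ˡ shift) >>= λ S →
    ¬¬-excluded-middle {A = ∃[ y ] app A (1# ∷ app (ι₂ S) y) ≋ 𝟘} >>= λ
      { (yes (y , Ay≋𝟘)) → return (enlarge-kernel A S y Ay≋𝟘)
      ; (no e₀∉image)    → return (enlarge-image A S e₀∉image)
      }

  injective-form⇒≤1 : (φ : r ⊸ 1) → Injective φ → r ℕ.≤ 1
  injective-form⇒≤1 {zero}        φ inj = z≤n
  injective-form⇒≤1 {suc zero}    φ inj = s≤s z≤n
  injective-form⇒≤1 {suc (suc r)} φ inj = contradiction (inj e₁ φe₁≋𝟘 (suc zero)) 1≉0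
    where
    e₀ e₁ w : V (suc (suc r))
    e₀ = 1# ∷ 𝟘
    e₁ = 0# ∷ (1# ∷ 𝟘)
    -- The standard dependency between two values of a form: `φ w = 0`, and the first coordinate of
    -- `w` is `φ e₁`, which injectivity then makes 0.
    w  = app φ e₁ zero · e₀ ⊕ (- app φ e₀ zero) · e₁

    φw≋𝟘 : app φ w ≋ 𝟘
    φw≋𝟘 zero = begin
      app φ w zero
        ≈⟨ trans (+-homo φ _ _ zero) (+-cong (·-homo φ _ _ zero) (·-homo φ _ _ zero)) ⟩
      app φ e₁ zero * app φ e₀ zero + - app φ e₀ zero * app φ e₁ zero
        ≈⟨ +-cong (*-comm _ _) (sym (-‿distribˡ-* _ _)) ⟩
      app φ e₀ zero * app φ e₁ zero + - (app φ e₀ zero * app φ e₁ zero)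
        ≈⟨ -‿inverseʳ _ ⟩
      0# ∎

    φe₁≋𝟘 : app φ e₁ ≋ 𝟘
    φe₁≋𝟘 zero = begin
      app φ e₁ zero        ≈⟨ *-identityʳ _ ⟨
      app φ e₁ zero * 1#   ≈⟨ x≈0⇒y+x≈y (zeroʳ _) ⟨
      w zero               ≈⟨ inj w φw≋𝟘 zero ⟩
      0#                   ∎

  -- Induction on the target: the remaining rows embed the kernel of the first row, and the first
  -- row embeds its complement into a line. Decidability of `≤` removes the double negation.
  injective⇒≤ : (A : p ⊸ q) → Injective A → p ℕ.≤ q
  injective⇒≤ {p} {q} A inj = decidable-stable (p ℕ.≤? q) (go A inj)
    where
    go : ∀ {p q} (A : p ⊸ q) → Injective A → ¬ ¬ (p ℕ.≤ q)
    go {zero}        A inj = return z≤n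
    go {suc p} {zero} A inj = contradiction (inj (λ _ → 1#) (λ ()) zero) 1≉0
    go {suc p} {suc q} A inj =
      kernelSplit row >>= λ S →
      go (tailˡ ∘ˡ A ∘ˡ ι₁ S) (λ v tail≋𝟘 → ι₁-injective S v (inj (app (ι₁ S) v)
        (λ { zero → kernel S v zero ; (suc i) → tail≋𝟘 i }))) >>= λ dimKernel≤q →
      return (≡.subst₂ ℕ._≤_ (dim-sum S) (ℕ.+-comm q 1)
        (ℕ.+-mono-≤ dimKernel≤q (injective-form⇒≤1 (row ∘ˡ ι₂ S) (A∘ι₂-injective S))))
      where
      row = reindex {m = 1} (λ _ → zero) ∘ˡ A

  -- Independence of products of anticommuting operators

  Anticommute : n ⊸ n → n ⊸ n → Set (c ⊔ ℓ)
  Anticommute f g = ∀ v → app f (app g v) ≋ ⊖ app g (app f v)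

  PairwiseAnticommute : (Fin k → n ⊸ n) → Set (c ⊔ ℓ)
  PairwiseAnticommute e = ∀ i j → i ≢ j → Anticommute (e i) (e j)

  anticommute-kernel : ∀ (f g : n ⊸ n) → Anticommute f g → ∀ v → app f v ≋ 𝟘 → app f (app g v) ≋ 𝟘
  anticommute-kernel f g fg v fv≋𝟘 i =
    trans (fg v i) (trans (-‿cong (0-homo g fv≋𝟘 i)) -0#≈0#)

  scale : Carrier → n ⊸ n
  scale a = record
    { app    = a ·_
    ; cong   = λ u≋v i → *-congˡ (u≋v i)
    ; +-homo = λ _ _ _ → distribˡ _ _ _
    ; ·-homo = λ b v i → x∙yz≈y∙xz a b (v i)
    }

  basis : Fin n → V n
  basis zero    = 1# ∷ 𝟘
  basis (suc i) = 0# ∷ basis i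

  ≋𝟘-on-basis : (f : n ⊸ m) → (∀ i → app f (basis i) ≋ 𝟘) → ∀ v → app f v ≋ 𝟘
  ≋𝟘-on-basis {zero}  f f≋𝟘 v = 0-homo f λ ()
  ≋𝟘-on-basis {suc n} f f≋𝟘 v i = begin
    app f v i
      ≈⟨ cong f (λ { zero    → sym (trans (+-identityʳ _) (*-identityʳ _))
                   ; (suc _) → sym (x≈0⇒x+y≈y (zeroʳ _)) }) i ⟩
    app f (v zero · basis zero ⊕ (0# ∷ tail v)) i
      ≈⟨ trans (+-homo f _ _ i) (+-congʳ (·-homo f _ _ i)) ⟩
    v zero * app f (basis zero) i + app f (0# ∷ tail v) i
      ≈⟨ +-cong (y≈0⇒xy≈0 (f≋𝟘 zero i)) (≋𝟘-on-basis (f ∘ˡ shift) (f≋𝟘 ∘ suc) (tail v) i) ⟩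
    0# + 0#
      ≈⟨ +-identityˡ 0# ⟩
    0# ∎

  -- `2 ^ suc m` unfolds to `2 ^ m + (2 ^ m + 0)`, hence the empty last block. The halves stand for
  -- the subsets without and with the first generator.
  lowerHalf : Fin (2 ℕ.^ m) → Fin (2 ℕ.^ suc m)
  lowerHalf {m} i = i ↑ˡ (2 ℕ.^ m ℕ.+ 0)

  upperHalf : Fin (2 ℕ.^ m) → Fin (2 ℕ.^ suc m)
  upperHalf {m} i = 2 ℕ.^ m ↑ʳ (i ↑ˡ 0)

  ∀-halves : ∀ {p} {P : Fin (2 ℕ.^ suc m) → Set p} →
    (∀ i → P (lowerHalf {m} i)) → (∀ i → P (upperHalf {m} i)) → ∀ i → P i
  ∀-halves {m} {P = P} l u = ∀-split l (∀-split {P = P ∘ (2 ℕ.^ m ↑ʳ_)} u λ ())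

  -- The coefficients c are indexed by the 2 ^ m subsets I of Fin m, and the
  -- operator is the sum over I of c I times the ordered product of a i, i ∈ I.
  polynomial : (Fin m → n ⊸ n) → V (2 ℕ.^ m) → n ⊸ n
  polynomial {zero}  a c = scale (c zero)
  polynomial {suc m} a c =
    polynomial (a ∘ suc) (c ∘ lowerHalf {m}) +ˡ a zero ∘ˡ polynomial (a ∘ suc) (c ∘ upperHalf {m})

  -- The operator `polynomial` evaluated at a fixed vector, as a linear map of the coefficients: the
  -- dimension count needs linearity in this argument.
  polynomialAt : (Fin m → n ⊸ n) → V n → 2 ℕ.^ m ⊸ n
  polynomialAt {zero}  a v = headˡ v
  polynomialAt {suc m} a v =
    polynomialAt (a ∘ suc) v ∘ˡ reindex (lowerHalf {m})
      +ˡ a zero ∘ˡ polynomialAt (a ∘ suc) v ∘ˡ reindex (upperHalf {m})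

  polynomialAt-app : ∀ (a : Fin m → n ⊸ n) v c → app (polynomialAt a v) c ≋ app (polynomial a c) v
  polynomialAt-app {zero}  a v c i = refl
  polynomialAt-app {suc m} a v c i =
    +-cong (polynomialAt-app (a ∘ suc) v (c ∘ lowerHalf {m}) i)
      (cong (a zero) (polynomialAt-app (a ∘ suc) v (c ∘ upperHalf {m})) i)

  polynomial-commute : ∀ (t : n ⊸ n) (a : Fin m → n ⊸ n) →
    (∀ i v → app t (app (a i) v) ≋ app (a i) (app t v)) →
    ∀ c v → app t (app (polynomial a c) v) ≋ app (polynomial a c) (app t v)
  polynomial-commute {m = zero}  t a ta c v i = ·-homo t _ v i
  polynomial-commute {m = suc m} t a ta c v i = trans (+-homo t _ _ i) (+-cong
    (polynomial-commute t (a ∘ suc) (ta ∘ suc) _ v i)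
    (trans (ta zero _ i) (cong (a zero) (polynomial-commute t (a ∘ suc) (ta ∘ suc) _ v) i)))

  -- A relation P + a₀ Q = 0 between polynomials in the later generators splits:
  -- t = a₀ b commutes with P and Q but anticommutes with a₀, so 2 t P = 0.
  polynomial-injective : ∀ (b : suc n ⊸ suc n) (a : Fin m → suc n ⊸ suc n) →
    Injective b → (∀ i → Injective (a i)) →
    (∀ i → Anticommute b (a i)) → PairwiseAnticommute a →
    ∀ c → (∀ v → app (polynomial a c) v ≋ 𝟘) → c ≋ 𝟘
  polynomial-injective {m = zero}  b a b-inj a-inj ba aa c p≋𝟘 zero =
    -- The dimension `suc n` provides a coordinate, and a scalar operator at the all-ones vector
    -- returns its scalar there.
    trans (sym (*-identityʳ _)) (p≋𝟘 (λ _ → 1#) zero)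
  polynomial-injective {n = n} {m = suc m} b a b-inj a-inj ba aa c p≋𝟘 = ∀-halves {m}
    (recurse (c ∘ lowerHalf {m}) P≋𝟘)
    (recurse (c ∘ upperHalf {m}) Q≋𝟘)
    where
    recurse = polynomial-injective b (a ∘ suc) b-inj (a-inj ∘ suc) (ba ∘ suc)
      (λ i j i≢j → aa (suc i) (suc j) (i≢j ∘ Fin.suc-injective))

    P Q t : suc n ⊸ suc n
    P = polynomial (a ∘ suc) (c ∘ lowerHalf {m})
    Q = polynomial (a ∘ suc) (c ∘ upperHalf {m})
    t = a zero ∘ˡ b

    -- Moving `t` past a later generator costs one sign for `b` and one for `a zero`.
    t-commute : ∀ i v → app t (app (a (suc i)) v) ≋ app (a (suc i)) (app t v)
    t-commute i v j = begin
      app (a zero) (app b (app (a (suc i)) v)) j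
        ≈⟨ cong (a zero) (ba (suc i) v) j ⟩
      app (a zero) (⊖ app (a (suc i)) (app b v)) j
        ≈⟨ ⊖-homo (a zero) _ j ⟩
      - app (a zero) (app (a (suc i)) (app b v)) j
        ≈⟨ -‿cong (aa zero (suc i) (λ ()) (app b v) j) ⟩
      - (- app (a (suc i)) (app (a zero) (app b v)) j)
        ≈⟨ -‿involutive _ ⟩
      app (a (suc i)) (app (a zero) (app b v)) j ∎

    -- Only `b` contributes a sign, as `a zero` moves past itself.
    t-anticommute : Anticommute t (a zero)
    t-anticommute v j = trans (cong (a zero) (ba zero v) j) (⊖-homo (a zero) _ j)

    -- The relation at `t v` and the image under `t` of the relation at `v` share the term `t P v`
    -- and have opposite second terms.
    tP+tP≈0 : ∀ v j → app t (app P v) j + app t (app P v) j ≈ 0#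
    tP+tP≈0 v j = begin
      tPv + tPv                   ≈⟨ +-cong (+-identityʳ _) (+-identityʳ _) ⟨
      (tPv + 0#) + (tPv + 0#)     ≈⟨ +-congʳ (+-congˡ (-‿inverseʳ a₀tQv)) ⟨
      (tPv + (a₀tQv + - a₀tQv)) + (tPv + 0#)
                                  ≈⟨ regroup tPv a₀tQv (- a₀tQv) ⟩
      (tPv + a₀tQv) + (tPv + - a₀tQv)
                                  ≈⟨ +-cong at-tv t-at-v ⟩
      0# + 0#                     ≈⟨ +-identityˡ 0# ⟩
      0#                          ∎
      where
      tPv   = app t (app P v) j
      a₀tQv = app (a zero) (app t (app Q v)) j
      regroup : ∀ x y z → (x + (y + z)) + (x + 0#) ≈ (x + y) + (x + z)
      regroup = solve 3 (λ x y z → (x :+ (y :+ z)) :+ (x :+ con 0) := (x :+ y) :+ (x :+ z)) refl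
      at-tv : tPv + a₀tQv ≈ 0#
      at-tv = trans (+-cong (polynomial-commute t (a ∘ suc) t-commute _ v j)
        (cong (a zero) (polynomial-commute t (a ∘ suc) t-commute _ v) j)) (p≋𝟘 (app t v) j)
      t-at-v : tPv + - a₀tQv ≈ 0#
      t-at-v = begin
        tPv + - a₀tQv                               ≈⟨ +-congˡ (t-anticommute (app Q v) j) ⟨
        tPv + app t (app (a zero) (app Q v)) j      ≈⟨ +-homo t _ _ j ⟨
        app t (app P v ⊕ app (a zero) (app Q v)) j  ≈⟨ 0-homo t (p≋𝟘 v) j ⟩
        0#                                          ∎

    P≋𝟘 : ∀ v → app P v ≋ 𝟘
    P≋𝟘 v = b-inj _ (a-inj zero _ λ j → x+x≈0⇒x≈0 _ (tP+tP≈0 v j))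

    Q≋𝟘 : ∀ v → app Q v ≋ 𝟘
    Q≋𝟘 v = a-inj zero _ λ j → trans (sym (x≈0⇒x+y≈y (P≋𝟘 v j))) (p≋𝟘 v j)

  -- `a zero` is the operator kept out of the products. The coefficients of a polynomial in the
  -- other `m` embed into its matrix entries: the quotient of an index picks the basis vector, the
  -- remainder the coordinate.
  2^m≤n*n : ∀ (a : Fin (suc m) → suc n ⊸ suc n) → (∀ i → Injective (a i)) →
    PairwiseAnticommute a → 2 ℕ.^ m ℕ.≤ suc n ℕ.* suc n
  2^m≤n*n {m} {n} a a-inj aa = injective⇒≤ entries entries-injective
    where
    entries : 2 ℕ.^ m ⊸ suc n ℕ.* suc n
    entries = record
      { app    = λ c x → app (at x) c (row x)
      ; cong   = λ u≋v x → cong (at x) u≋v (row x)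
      ; +-homo = λ u v x → +-homo (at x) u v (row x)
      ; ·-homo = λ b v x → ·-homo (at x) b v (row x)
      }
      where
      at : Fin (suc n ℕ.* suc n) → 2 ℕ.^ m ⊸ suc n
      at x = polynomialAt (a ∘ suc) (basis (Fin.quotient {suc n} (suc n) x))
      row : Fin (suc n ℕ.* suc n) → Fin (suc n)
      row = Fin.remainder {suc n} (suc n)

    entries-injective : Injective entries
    entries-injective c entries≋𝟘 =
      polynomial-injective (a zero) (a ∘ suc) (a-inj zero) (a-inj ∘ suc) (λ i → aa zero (suc i) λ ())
        (λ i j i≢j → aa (suc i) (suc j) (i≢j ∘ Fin.suc-injective)) c
        (≋𝟘-on-basis (polynomial (a ∘ suc) c) λ i j →
          trans (sym (polynomialAt-app (a ∘ suc) (basis i) c j))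
            (≡.subst (λ (x , y) → app (polynomialAt (a ∘ suc) (basis x)) c y ≈ 0#)
              (Fin.remQuot-combine {suc n} i j) (entries≋𝟘 (Fin.combine i j))))

  -- Powers of block triangular operators

  0ˡ : m ⊸ n
  0ˡ = record
    { app = λ _ → 𝟘 ; cong = λ _ _ → refl
    ; +-homo = λ _ _ _ → sym (+-identityˡ 0#) ; ·-homo = λ a _ _ → sym (zeroʳ a) }

  infixr 10 _^ˡ_

  _^ˡ_ : n ⊸ n → ℕ → n ⊸ n
  f ^ˡ zero  = idˡ
  f ^ˡ suc m = f ∘ˡ f ^ˡ m

  ^ˡ-+ : ∀ (f : n ⊸ n) a b v → app (f ^ˡ (a ℕ.+ b)) v ≋ app (f ^ˡ a) (app (f ^ˡ b) v)
  ^ˡ-+ f zero    b v = ≋-refl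
  ^ˡ-+ f (suc a) b v = cong f (^ˡ-+ f a b v)

  0^ˡ : ∀ (f : n ⊸ n) → (∀ v → app f v ≋ 𝟘) → ∀ v → app (f ^ˡ n) v ≋ 𝟘
  -- The zeroth power is the identity, but the space has no coordinates.
  0^ˡ {zero}  f f≋𝟘 v = λ ()
  0^ˡ {suc n} f f≋𝟘 v = f≋𝟘 _

  -- Rank at most `r`, in a form that composes with inclusions and projections and requires no
  -- choice of columns.
  FactorsThrough : n ⊸ n → ℕ → Set (c ⊔ ℓ)
  FactorsThrough {n} f r = ∃[ g ] ∃[ h ] (∀ v → app f v ≋ app {r} {n} h (app {n} {r} g v))

  -- In a basis adapted to the invariant kernel of A the operator f is block
  -- triangular, with diagonal blocks sub f and quo f.
  module Triangular {A : n ⊸ n} (S : KernelSplit A) where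

    sub : n ⊸ n → dimKernel S ⊸ dimKernel S
    sub f = π₁ S ∘ˡ f ∘ˡ ι₁ S

    quo : n ⊸ n → dimImage S ⊸ dimImage S
    quo f = π₂ S ∘ˡ f ∘ˡ ι₂ S

    PreservesKernel : n ⊸ n → Set (c ⊔ ℓ)
    PreservesKernel f = ∀ v → app A v ≋ 𝟘 → app A (app f v) ≋ 𝟘

    private
      split : ∀ (g : n ⊸ m) v →
        app g v ≋ app g (app (ι₁ S) (app (π₁ S) v)) ⊕ app g (app (ι₂ S) (app (π₂ S) v))
      split g v i = trans (cong g (≋-sym (recombine S v)) i) (+-homo g _ _ i)

    -- `f` keeps the image of `ι₁` inside the kernel, where the `π₂` coordinates vanish, so only the
    -- `ι₁` part remains.
    f∘ι₁ : ∀ f → PreservesKernel f → ∀ v → app f (app (ι₁ S) v) ≋ app (ι₁ S) (app (sub f) v)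
    f∘ι₁ f pres v i = trans (split idˡ (app f (app (ι₁ S) v)) i)
      (x≈0⇒y+x≈y (0-homo (ι₂ S) (π₂-kernel S _ (pres _ (kernel S v))) i))

    -- Dually, the `ι₁` component of `v` stays in the kernel under `f` and is invisible to `π₂`.
    π₂∘f : ∀ f → PreservesKernel f → ∀ v → app (π₂ S) (app f v) ≋ app (quo f) (app (π₂ S) v)
    π₂∘f f pres v i = trans (split (π₂ S ∘ˡ f) v i)
      (x≈0⇒x+y≈y (π₂-kernel S _ (pres _ (kernel S _)) i))

    sub-anticommute : ∀ f g → PreservesKernel f → PreservesKernel g →
      Anticommute f g → Anticommute (sub f) (sub g)
    sub-anticommute f g f-pres g-pres fg v i = begin
      app (π₁ S) (app f (app (ι₁ S) (app (sub g) v))) i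
        ≈⟨ cong (π₁ S ∘ˡ f) (f∘ι₁ g g-pres v) i ⟨
      app (π₁ S) (app f (app g (app (ι₁ S) v))) i
        ≈⟨ cong (π₁ S) (fg _) i ⟩
      app (π₁ S) (⊖ app g (app f (app (ι₁ S) v))) i
        ≈⟨ ⊖-homo (π₁ S) _ i ⟩
      - app (π₁ S) (app g (app f (app (ι₁ S) v))) i
        ≈⟨ -‿cong (cong (π₁ S ∘ˡ g) (f∘ι₁ f f-pres v) i) ⟩
      - app (sub g) (app (sub f) v) i ∎

    quo-anticommute : ∀ f g → PreservesKernel f → PreservesKernel g →
      Anticommute f g → Anticommute (quo f) (quo g)
    quo-anticommute f g f-pres g-pres fg v i = begin
      app (quo f) (app (quo g) v) i
        ≈⟨ π₂∘f f f-pres _ i ⟨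
      app (π₂ S) (app f (app g (app (ι₂ S) v))) i
        ≈⟨ cong (π₂ S) (fg _) i ⟩
      app (π₂ S) (⊖ app g (app f (app (ι₂ S) v))) i
        ≈⟨ ⊖-homo (π₂ S) _ i ⟩
      - app (π₂ S) (app g (app f (app (ι₂ S) v))) i
        ≈⟨ -‿cong (π₂∘f g g-pres _ i) ⟩
      - app (quo g) (app (quo f) v) i ∎

    f^∘ι₁ : ∀ f → PreservesKernel f → ∀ m v →
      app (f ^ˡ m) (app (ι₁ S) v) ≋ app (ι₁ S) (app (sub f ^ˡ m) v)
    f^∘ι₁ f pres zero    v = ≋-refl
    f^∘ι₁ f pres (suc m) v = ≋-trans (cong f (f^∘ι₁ f pres m v)) (f∘ι₁ f pres _)

    π₂∘f^ : ∀ f → PreservesKernel f → ∀ m v →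
      app (π₂ S) (app (f ^ˡ m) v) ≋ app (quo f ^ˡ m) (app (π₂ S) v)
    π₂∘f^ f pres zero    v = ≋-refl
    π₂∘f^ f pres (suc m) v = ≋-trans (π₂∘f f pres _) (cong (quo f) (π₂∘f^ f pres m v))

    -- With d = dimKernel S and r = dimImage S,
    --   fᵈ⁺ʳ = fᵈ (ι₁ π₁ + ι₂ π₂) fʳ = ι₁ (sub f)ᵈ π₁ fʳ + fᵈ ι₂ (quo f)ʳ π₂.
    ^ˡ-factors : ∀ f {a b} → PreservesKernel f →
      FactorsThrough (sub f ^ˡ dimKernel S) a → FactorsThrough (quo f ^ˡ dimImage S) b →
      FactorsThrough (f ^ˡ n) (a ℕ.+ b)
    ^ˡ-factors f pres (g₁ , h₁ , eq₁) (g₂ , h₂ , eq₂) =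
      pair (g₁ ∘ˡ π₁ S ∘ˡ f ^ˡ dimImage S) (g₂ ∘ˡ π₂ S) ,
      copair (ι₁ S ∘ˡ h₁) (f ^ˡ dimKernel S ∘ˡ ι₂ S ∘ˡ h₂) ,
      λ v i → begin
        app (f ^ˡ n) v i
          ≡⟨ ≡.cong (λ m → app (f ^ˡ m) v i) (dim-sum S) ⟨
        app (f ^ˡ (dimKernel S ℕ.+ dimImage S)) v i
          ≈⟨ ^ˡ-+ f (dimKernel S) (dimImage S) v i ⟩
        app (f ^ˡ dimKernel S) (app (f ^ˡ dimImage S) v) i
          ≈⟨ split (f ^ˡ dimKernel S) _ i ⟩
        app (f ^ˡ dimKernel S) (app (ι₁ S) (app (π₁ S) (app (f ^ˡ dimImage S) v))) i
          + app (f ^ˡ dimKernel S) (app (ι₂ S) (app (π₂ S) (app (f ^ˡ dimImage S) v))) i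
          ≈⟨ +-cong
               (≋-trans (f^∘ι₁ f pres (dimKernel S) _) (cong (ι₁ S) (eq₁ _)) i)
               (cong (f ^ˡ dimKernel S ∘ˡ ι₂ S) (≋-trans (π₂∘f^ f pres (dimImage S) v) (eq₂ _)) i) ⟩
        app (ι₁ S) (app h₁ (app g₁ (app (π₁ S) (app (f ^ˡ dimImage S) v)))) i
          + app (f ^ˡ dimKernel S) (app (ι₂ S) (app h₂ (app g₂ (app (π₂ S) v)))) i
          ≈⟨ copair-pair (ι₁ S ∘ˡ h₁) (f ^ˡ dimKernel S ∘ˡ ι₂ S ∘ˡ h₂)
               (g₁ ∘ˡ π₁ S ∘ˡ f ^ˡ dimImage S) (g₂ ∘ˡ π₂ S) v i ⟨
        _ ∎

  -- Rank bounds by induction on the dimension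

  -- The numbers `r` are upper bounds for the ranks and are additive over blocks, so the induction
  -- can produce them without comparing exact ranks.
  RankBounds : (Fin k → n ⊸ n) → Set (c ⊔ ℓ)
  RankBounds {n = n} e = ∃[ r ] (∀ i → FactorsThrough (e i ^ˡ n) (r i)) ×
    2 ℕ.^ sumℕ r ℕ.≤ (2 ℕ.* (n ℕ.* n)) ℕ.^ n

  rankBounds-irreducible : (e : Fin k → n ⊸ n) → PairwiseAnticommute e →
    (∀ i → (∀ v → app (e i) v ≋ 𝟘) ⊎ Injective (e i)) → RankBounds e
  rankBounds-irreducible {k} {n} e ee zero-or-inj =
    let m , s , s-inj , es-inj , sum≡ = selected rk rk-cases
    in rk , factors , ℕ.≤-trans
         (ℕ.≤-reflexive (≡.trans (≡.cong (2 ℕ.^_) sum≡) (≡.sym (ℕ.^-*-assoc 2 m n))))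
         (bound n m (λ j → e (s j)) es-inj (λ i j i≢j → ee (s i) (s j) (i≢j ∘ s-inj)))
    where
    rk : Fin k → ℕ
    rk i = [ (λ _ → 0) , (λ _ → n) ] (zero-or-inj i)

    rk-cases : ∀ i → rk i ≡ 0 ⊎ (rk i ≡ n × Injective (e i))
    rk-cases i with zero-or-inj i
    ... | inj₁ _   = inj₁ ≡.refl
    ... | inj₂ inj = inj₂ (≡.refl , inj)

    factors : ∀ i → FactorsThrough (e i ^ˡ n) (rk i)
    factors i with zero-or-inj i
    ... | inj₁ e≋𝟘 = 0ˡ , 0ˡ , 0^ˡ (e i) e≋𝟘
    ... | inj₂ _   = idˡ , e i ^ˡ n , λ _ → ≋-refl

    bound : ∀ n m (a : Fin m → n ⊸ n) → (∀ i → Injective (a i)) →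
      PairwiseAnticommute a → (2 ℕ.^ m) ℕ.^ n ℕ.≤ (2 ℕ.* (n ℕ.* n)) ℕ.^ n
    bound zero    m       a a-inj aa = s≤s z≤n
    -- With no injective member there is none to keep out, and `1 ≤ 2 n²` suffices.
    bound (suc n) zero    a a-inj aa = ℕ.^-monoˡ-≤ (suc n) (s≤s z≤n)
    bound (suc n) (suc m) a a-inj aa = ℕ.^-monoˡ-≤ (suc n) (ℕ.*-monoʳ-≤ 2 (2^m≤n*n a a-inj aa))

  rankBounds-triangular : ∀ {A : n ⊸ n} (S : KernelSplit A) (e : Fin k → n ⊸ n) →
    (∀ i → Triangular.PreservesKernel S (e i)) →
    RankBounds (Triangular.sub S ∘ e) → RankBounds (Triangular.quo S ∘ e) → RankBounds e
  rankBounds-triangular {n} S e pres (r₁ , factors₁ , bound₁) (r₂ , factors₂ , bound₂) =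
    (λ i → r₁ i ℕ.+ r₂ i) ,
    (λ i → Triangular.^ˡ-factors S (e i) (pres i) (factors₁ i) (factors₂ i)) ,
    ≡.subst₂ (λ a b → 2 ℕ.^ a ℕ.≤ (2 ℕ.* (b ℕ.* b)) ℕ.^ b)
      (≡.sym (∑-distrib-+ r₁ r₂)) (dim-sum S)
      (bounds-superadditive (dimKernel S) (dimImage S) (sumℕ r₁) (sumℕ r₂) bound₁ bound₂)

  trivial-split : ∀ {A : n ⊸ n} (S : KernelSplit A) → dimKernel S ≡ 0 ⊎ dimImage S ≡ 0 →
    (∀ v → app A v ≋ 𝟘) ⊎ Injective A
  trivial-split {A = A} S (inj₁ d≡0) = inj₂ λ v Av≋𝟘 i → begin
    v i
      ≈⟨ recombine S v i ⟨
    app (ι₁ S) (app (π₁ S) v) i + app (ι₂ S) (app (π₂ S) v) i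
      ≈⟨ +-cong (0-homo (ι₁ S) (empty d≡0 _) i) (0-homo (ι₂ S) (π₂-kernel S v Av≋𝟘) i) ⟩
    0# + 0#
      ≈⟨ +-identityˡ 0# ⟩
    0# ∎
    where
    empty : d ≡ 0 → ∀ (v : V d) → v ≋ 𝟘
    empty ≡.refl v ()
  trivial-split {A = A} S (inj₂ r≡0) = inj₁ λ v i → begin
    app A v i
      ≈⟨ cong A (recombine S v) i ⟨
    app A (app (ι₁ S) (app (π₁ S) v) ⊕ app (ι₂ S) (app (π₂ S) v)) i
      ≈⟨ +-homo A _ _ i ⟩
    app A (app (ι₁ S) (app (π₁ S) v)) i + app A (app (ι₂ S) (app (π₂ S) v)) i
      ≈⟨ +-cong (kernel S _ i) (0-homo (A ∘ˡ ι₂ S) (empty r≡0 _) i) ⟩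
    0# + 0#
      ≈⟨ +-identityˡ 0# ⟩
    0# ∎
    where
    empty : r ≡ 0 → ∀ (v : V r) → v ≋ 𝟘
    empty ≡.refl v ()

  rankBounds : ∀ n (e : Fin k → n ⊸ n) → PairwiseAnticommute e → ¬ ¬ RankBounds e
  rankBounds {k} = <-rec (λ n → (e : Fin k → n ⊸ n) → PairwiseAnticommute e → ¬ ¬ RankBounds e) step
    where
    step : ∀ n → (∀ {m} → m ℕ.< n → (e : Fin k → m ⊸ m) → PairwiseAnticommute e → ¬ ¬ RankBounds e) →
      (e : Fin k → n ⊸ n) → PairwiseAnticommute e → ¬ ¬ RankBounds e
    -- The family is finite, so all splittings are available under one double negation. Their
    -- dimensions are naturals, so the search for a proper kernel is decidable.
    step n rec e ee = Fin.sequence ¬¬-applicative (kernelSplit ∘ e) >>= by-splits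
      where
      by-splits : (∀ i → KernelSplit (e i)) → ¬ ¬ RankBounds e
      by-splits S with Fin.any? (λ i → (0 ℕ.<? dimKernel (S i)) ×-dec (0 ℕ.<? dimImage (S i)))
      ... | no no-proper = return (rankBounds-irreducible e ee λ i → trivial-split (S i)
              (improper _ _ (λ proper → no-proper (i , proper))))
        where
        improper : ∀ d r → ¬ (0 ℕ.< d × 0 ℕ.< r) → d ≡ 0 ⊎ r ≡ 0
        improper zero    r       _  = inj₁ ≡.refl
        improper (suc d) zero    _  = inj₂ ≡.refl
        improper (suc d) (suc r) ¬p = contradiction (s≤s z≤n , s≤s z≤n) ¬p
      ... | yes (i , 0<d , 0<r) =
              rec d<n (sub ∘ e) (λ j l j≢l → sub-anticommute (e j) (e l) (pres j) (pres l) (ee j l j≢l)) >>= λ bounds₁ →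
              rec r<n (quo ∘ e) (λ j l j≢l → quo-anticommute (e j) (e l) (pres j) (pres l) (ee j l j≢l)) >>= λ bounds₂ →
              return (rankBounds-triangular (S i) e pres bounds₁ bounds₂)
        where
        open Triangular (S i)
        pres : ∀ j → PreservesKernel (e j)
        pres j with i Fin.≟ j
        -- Anticommutation concerns distinct indices only; `e i` itself maps its kernel to 0.
        ... | yes ≡.refl = λ v ev≋𝟘 → 0-homo (e i) ev≋𝟘
        ... | no i≢j     = anticommute-kernel (e i) (e j) (ee i j i≢j)
        d<n : dimKernel (S i) ℕ.< n
        d<n = ≡.subst (_ ℕ.<_) (dim-sum (S i)) (ℕ.m<m+n _ 0<r)
        r<n : dimImage (S i) ℕ.< n
        r<n = ≡.subst (_ ℕ.<_) (dim-sum (S i)) (ℕ.m<n+m _ 0<d)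

  -- From matrices to linear maps

  open Matrices rawRing

  toLinear : Matrix n → n ⊸ n
  toLinear A = record
    { app    = λ v i → sum λ l → A i l * v l
    ; cong   = λ u≋v i → sum-cong-≋ λ l → *-congˡ (u≋v l)
    ; +-homo = λ u v i → trans (sum-cong-≋ λ l → distribˡ (A i l) (u l) (v l)) (K-∑-distrib-+ (λ l → A i l * u l) (λ l → A i l * v l))
    ; ·-homo = λ a v i → trans (sum-cong-≋ λ l → x∙yz≈y∙xz (A i l) a (v l)) (sym (*-distribˡ-sum a (λ l → A i l * v l)))
    }

  toLinear-* : ∀ (A B : Matrix n) v → app (toLinear (A *ᴹ B)) v ≋ app (toLinear A) (app (toLinear B) v)
  toLinear-* A B v i = begin
    sum (λ l → sum (λ j → A i j * B j l) * v l)
      ≈⟨ (sum-cong-≋ λ l → trans (*-distribʳ-sum (v l) (λ j → A i j * B j l))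
            (sum-cong-≋ λ j → *-assoc (A i j) (B j l) (v l))) ⟩
    sum (λ l → sum (λ j → A i j * (B j l * v l)))
      ≈⟨ ∑-comm (λ l j → A i j * (B j l * v l)) ⟩
    sum (λ j → sum (λ l → A i j * (B j l * v l)))
      ≈⟨ (sum-cong-≋ λ j → *-distribˡ-sum (A i j) (λ l → B j l * v l)) ⟨
    sum (λ j → A i j * sum (λ l → B j l * v l)) ∎

  sum-0 : ∀ (f : V n) → f ≋ 𝟘 → sum f ≈ 0#
  sum-0 {n} f f≋𝟘 = trans (sum-cong-≋ f≋𝟘) (sum-replicate-zero n)

  toLinear-1 : ∀ v → app (toLinear (1ᴹ {n})) v ≋ v
  toLinear-1 {suc n} v zero =
    trans (x≈0⇒y+x≈y (sum-0 {n} _ λ l → zeroˡ _)) (*-identityˡ _)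
  toLinear-1 {suc n} v (suc i) = trans (x≈0⇒x+y≈y (zeroˡ _)) (toLinear-1 (tail v) i)

  toLinear-^ : ∀ (A : Matrix n) m v → app (toLinear (A ^ᴹ m)) v ≋ app (toLinear A ^ˡ m) v
  toLinear-^ A zero    v = toLinear-1 v
  toLinear-^ A (suc m) v = ≋-trans (toLinear-* A (A ^ᴹ m) v) (cong (toLinear A) (toLinear-^ A m v))

  toLinear-anticommute : ∀ (A B : Matrix n) → A *ᴹ B ≈ᴹ -ᴹ (B *ᴹ A) → Anticommute (toLinear A) (toLinear B)
  toLinear-anticommute A B AB v i = begin
    app (toLinear A) (app (toLinear B) v) i
      ≈⟨ toLinear-* A B v i ⟨
    sum (λ l → (A *ᴹ B) i l * v l)
      ≈⟨ (sum-cong-≋ λ l → trans (*-congʳ (AB i l)) (trans (sym (-‿distribˡ-* _ _)) (sym (-1*x≈-x _)))) ⟩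
    sum (λ l → - 1# * ((B *ᴹ A) i l * v l))
      ≈⟨ *-distribˡ-sum (- 1#) (λ l → (B *ᴹ A) i l * v l) ⟨
    - 1# * sum (λ l → (B *ᴹ A) i l * v l)
      ≈⟨ -1*x≈-x _ ⟩
    - sum (λ l → (B *ᴹ A) i l * v l)
      ≈⟨ -‿cong (toLinear-* B A v i) ⟩
    - app (toLinear B) (app (toLinear A) v) i ∎

  sum-basis : ∀ (f : V n) j → sum (λ l → f l * basis j l) ≈ f j
  sum-basis {suc n} f zero    = trans (x≈0⇒y+x≈y (sum-0 {n} _ λ l → zeroʳ _)) (*-identityʳ _)
  sum-basis {suc n} f (suc j) = trans (x≈0⇒x+y≈y (zeroʳ _)) (sum-basis (tail f) j)

  embed : (Fin k → Fin n) → k ⊸ n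
  embed {zero}  s = 0ˡ
  embed {suc k} s = headˡ (basis (s zero)) +ˡ embed (s ∘ suc) ∘ˡ tailˡ

  toLinear-embed : ∀ (A : Matrix n) (s : Fin k → Fin n) a i →
    app (toLinear A) (app (embed s) a) i ≈ sum (λ j → a j * columns A s j i)
  toLinear-embed {k = zero}  A s a i = 0-homo (toLinear A) (λ _ → refl) i
  toLinear-embed {k = suc k} A s a i = trans (+-homo (toLinear A) _ _ i) (+-cong
    (trans (·-homo (toLinear A) _ _ i) (*-congˡ (sum-basis (A i) (s zero))))
    (toLinear-embed A (s ∘ suc) (tail a) i))

  -- If `g` kills `embed s a`, so does `A`. But `A` sends `embed s a` to a combination of the
  -- selected columns, so independence forces `a` to vanish, and `ρ` coordinates embed into `r`.
  rank≤ : ∀ (A : Matrix n) (f : n ⊸ n) {r ρ} → (∀ v → app (toLinear A) v ≋ app f v) →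
    FactorsThrough f r → IsRank A ρ → ρ ℕ.≤ r
  rank≤ A f A≋f (g , h , f≋hg) ((s , independent) , _) =
    injective⇒≤ (g ∘ˡ embed s) λ a ga≋𝟘 → independent a λ i →
      trans (sym (toLinear-embed A s a i))
        (trans (A≋f _ i) (trans (f≋hg _ i) (0-homo h ga≋𝟘 i)))

  rankBound : RankBound (CommutativeRing.rawRing K)
  rankBound = record
    { 2^∑rk≤ = λ n k e ee rk isRank → decidable-stable (_ ℕ.≤? _)
        (rankBounds n (toLinear ∘ e) (λ i j i≢j → toLinear-anticommute (e i) (e j) (ee i j i≢j))
          >>= λ (r , factors , bound) →
        return (ℕ.≤-trans
          (ℕ.^-monoʳ-≤ 2 (sumℕ-mono λ i →
            rank≤ (e i ^ᴹ n) (toLinear (e i) ^ˡ n) (toLinear-^ (e i) n) (factors i) (isRank i)))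
          bound))
    }

-- Real and complex numbers

Eventually : (ℕ → Set) → Set
Eventually P = ∃[ N ] ∀ i → N ℕ.≤ i → P i

eventually-map : ∀ {P Q : ℕ → Set} → (∀ i → P i → Q i) → Eventually P → Eventually Q
eventually-map f (N , p) = N , λ i N≤i → f i (p i N≤i)

eventually-× : ∀ {P Q : ℕ → Set} → Eventually P → Eventually Q → Eventually (λ i → P i × Q i)
eventually-× (M , p) (N , q) = M ℕ.⊔ N , λ i le →
  p i (ℕ.m⊔n≤o⇒m≤o M N le) , q i (ℕ.m⊔n≤o⇒n≤o M N le)

-- `x ≈ℝ y` says that the difference is null, so the congruence laws reduce to closure properties of
-- null sequences.
Null : (ℕ → ℚ) → Set
Null x = ∀ ε → 0ℚ ℚ.< ε → Eventually (λ i → ∣ x i ∣ ℚ.< ε)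

Bounded : (ℕ → ℚ) → Set
Bounded x = ∃[ B ] Positive B × Eventually (λ i → ∣ x i ∣ ℚ.≤ B)

-- The positive form of being nonzero: the explicit `δ` controls the reciprocal.
Apart0 : (ℕ → ℚ) → Set
Apart0 x = ∃[ δ ] Positive δ × Eventually (λ i → δ ℚ.≤ ∣ x i ∣)

null-cong : ∀ {x y} → (∀ i → x i ≡ y i) → Null x → Null y
null-cong x≡y null ε 0<ε = eventually-map (λ i → ≡.subst (λ a → ∣ a ∣ ℚ.< ε) (x≡y i)) (null ε 0<ε)

null-neg : ∀ {x} → Null x → Null (λ i → ℚ.- x i)
null-neg {x} null ε 0<ε = eventually-map (λ i → ≡.subst (ℚ._< ε) (≡.sym (ℚ.∣-p∣≡∣p∣ (x i)))) (null ε 0<ε)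

½ε>0 : ∀ {ε} → 0ℚ ℚ.< ε → 0ℚ ℚ.< ½ ℚ.* ε
½ε>0 {ε} 0<ε = ≡.subst (ℚ._< ½ ℚ.* ε) (ℚ.*-zeroʳ ½) (ℚ.*-monoʳ-<-pos ½ 0<ε)

½ε+½ε≡ε : ∀ ε → ½ ℚ.* ε ℚ.+ ½ ℚ.* ε ≡ ε
½ε+½ε≡ε ε = ≡.trans (≡.sym (ℚ.*-distribʳ-+ ε ½ ½)) (ℚ.*-identityˡ ε)

null-+ : ∀ {x y} → Null x → Null y → Null (λ i → x i ℚ.+ y i)
null-+ {x} {y} x-null y-null ε 0<ε = eventually-map
  (λ i (x<½ε , y<½ε) → ≡.subst (∣ x i ℚ.+ y i ∣ ℚ.<_) (½ε+½ε≡ε ε)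
    (ℚ.≤-<-trans (ℚ.∣p+q∣≤∣p∣+∣q∣ (x i) (y i)) (ℚ.+-mono-< x<½ε y<½ε)))
  (eventually-× (x-null _ (½ε>0 0<ε)) (y-null _ (½ε>0 0<ε)))

bounded-*-null : ∀ {x y} → Bounded x → Null y → Null (λ i → x i ℚ.* y i)
bounded-*-null {x} {y} (B , posB , x≤B) y-null ε 0<ε = eventually-map bound (eventually-× x≤B (y-null δ 0<δ))
  where
  open ℚ.≤-Reasoning
  instance
    _ = posB
    _ = ℚ.pos⇒nonZero B
    _ = ℚ.1/pos⇒pos B
  δ = ℚ.1/ B ℚ.* ε
  0<δ : 0ℚ ℚ.< δ
  0<δ = ≡.subst (ℚ._< δ) (ℚ.*-zeroʳ (ℚ.1/ B)) (ℚ.*-monoʳ-<-pos (ℚ.1/ B) 0<ε)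
  bound : ∀ i → ∣ x i ∣ ℚ.≤ B × ∣ y i ∣ ℚ.< δ → ∣ x i ℚ.* y i ∣ ℚ.< ε
  bound i (xᵢ≤B , yᵢ<δ) = begin-strict
    ∣ x i ℚ.* y i ∣          ≡⟨ ℚ.∣p*q∣≡∣p∣*∣q∣ (x i) (y i) ⟩
    ∣ x i ∣ ℚ.* ∣ y i ∣      ≤⟨ ℚ.*-monoʳ-≤-nonNeg ∣ y i ∣ {{ℚ.∣-∣-nonNeg (y i)}} xᵢ≤B ⟩
    B ℚ.* ∣ y i ∣            <⟨ ℚ.*-monoʳ-<-pos B yᵢ<δ ⟩
    B ℚ.* (ℚ.1/ B ℚ.* ε)     ≡⟨ ℚ.*-assoc B (ℚ.1/ B) ε ⟨
    B ℚ.* ℚ.1/ B ℚ.* ε       ≡⟨ ≡.cong (ℚ._* ε) (ℚ.*-inverseʳ B) ⟩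
    1ℚ ℚ.* ε                 ≡⟨ ℚ.*-identityˡ ε ⟩
    ε                        ∎

∣a∣<∣b∣+ε : ∀ a b {ε} → ∣ a ℚ.- b ∣ ℚ.< ε → ∣ a ∣ ℚ.< ∣ b ∣ ℚ.+ ε
∣a∣<∣b∣+ε a b {ε} a-b<ε = begin-strict
  ∣ a ∣                      ≡⟨ ≡.cong ∣_∣ (split a b) ⟩
  ∣ b ℚ.+ (a ℚ.- b) ∣        ≤⟨ ℚ.∣p+q∣≤∣p∣+∣q∣ b (a ℚ.- b) ⟩
  ∣ b ∣ ℚ.+ ∣ a ℚ.- b ∣      <⟨ ℚ.+-monoʳ-< ∣ b ∣ a-b<ε ⟩
  ∣ b ∣ ℚ.+ ε                ∎
  where
  open ℚ.≤-Reasoning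
  split : ∀ a b → a ≡ b ℚ.+ (a ℚ.- b)
  split = solve 2 (λ a b → a := b :+ (a :- b)) ≡.refl
    where open +-*-Solver

ℝ-bounded : ∀ x → Bounded (seq x)
ℝ-bounded x =
  let N , close = cauchy x 1ℚ (ℚ.positive⁻¹ 1ℚ)
  in ∣ seq x N ∣ ℚ.+ 1ℚ , ℚ.nonNeg+pos⇒pos ∣ seq x N ∣ {{ℚ.∣-∣-nonNeg (seq x N)}} 1ℚ ,
     N , λ i N≤i → ℚ.<⇒≤ (∣a∣<∣b∣+ε (seq x i) (seq x N) (close i N N≤i ℕ.≤-refl))

module _ where
  open +-*-Solver

  swap-difference : ∀ a b → ℚ.- (a ℚ.- b) ≡ b ℚ.- a
  swap-difference = solve 2 (λ a b → :- (a :- b) := b :- a) ≡.refl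

  telescope : ∀ a b c → (a ℚ.- b) ℚ.+ (b ℚ.- c) ≡ a ℚ.- c
  telescope = solve 3 (λ a b c → (a :- b) :+ (b :- c) := a :- c) ≡.refl

  +-difference : ∀ a b c d → (a ℚ.- b) ℚ.+ (c ℚ.- d) ≡ (a ℚ.+ c) ℚ.- (b ℚ.+ d)
  +-difference = solve 4 (λ a b c d → (a :- b) :+ (c :- d) := (a :+ c) :- (b :+ d)) ≡.refl

  *-difference : ∀ a b c d → d ℚ.* (a ℚ.- b) ℚ.+ a ℚ.* (c ℚ.- d) ≡ a ℚ.* c ℚ.- b ℚ.* d
  *-difference = solve 4 (λ a b c d → d :* (a :- b) :+ a :* (c :- d) := a :* c :- b :* d) ≡.refl

  neg-difference : ∀ a b → ℚ.- (a ℚ.- b) ≡ (ℚ.- a) ℚ.- (ℚ.- b)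
  neg-difference = solve 2 (λ a b → :- (a :- b) := (:- a) :- (:- b)) ≡.refl

≡⇒≈ℝ : ∀ {x y} → (∀ i → seq x i ≡ seq y i) → x ≈ℝ y
≡⇒≈ℝ {x} {y} x≡y = mk≈ λ ε 0<ε → 0 , λ i _ → ≡.subst (ℚ._< ε)
  (≡.sym (≡.cong ∣_∣ (≡.trans (≡.cong (ℚ._- seq y i) (x≡y i)) (ℚ.+-inverseʳ (seq y i))))) 0<ε

≈ℝ-sym : ∀ {x y} → x ≈ℝ y → y ≈ℝ x
≈ℝ-sym {x} {y} (mk≈ x≈y) = mk≈ (null-cong (λ i → swap-difference (seq x i) (seq y i)) (null-neg x≈y))

≈ℝ-trans : ∀ {x y z} → x ≈ℝ y → y ≈ℝ z → x ≈ℝ z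
≈ℝ-trans {x} {y} {z} (mk≈ x≈y) (mk≈ y≈z) = mk≈
  (null-cong (λ i → telescope (seq x i) (seq y i) (seq z i)) (null-+ x≈y y≈z))

+ℝ-cong : ∀ x y u v → x ≈ℝ y → u ≈ℝ v → x +ℝ u ≈ℝ y +ℝ v
+ℝ-cong x y u v (mk≈ x≈y) (mk≈ u≈v) = mk≈
  (null-cong (λ i → +-difference (seq x i) (seq y i) (seq u i) (seq v i)) (null-+ x≈y u≈v))

-ℝ-cong : ∀ x y → x ≈ℝ y → -ℝ x ≈ℝ -ℝ y
-ℝ-cong x y (mk≈ x≈y) = mk≈ (null-cong (λ i → neg-difference (seq x i) (seq y i)) (null-neg x≈y))

*ℝ-cong : ∀ x y u v → x ≈ℝ y → u ≈ℝ v → x *ℝ u ≈ℝ y *ℝ v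
*ℝ-cong x y u v (mk≈ x≈y) (mk≈ u≈v) = mk≈
  (null-cong (λ i → *-difference (seq x i) (seq y i) (seq u i) (seq v i))
    (null-+ {λ i → seq v i ℚ.* (seq x i ℚ.- seq y i)} {λ i → seq x i ℚ.* (seq u i ℚ.- seq v i)}
      (bounded-*-null {seq v} (ℝ-bounded v) x≈y) (bounded-*-null {seq x} (ℝ-bounded x) u≈v)))

apart⇒≉0 : ∀ {x} → Apart0 (seq x) → ¬ (x ≈ℝ fromℕ 0)
apart⇒≉0 {x} (δ , posδ , δ≤x) (mk≈ x≈0) =
  let N , p = eventually-× δ≤x (x≈0 δ (ℚ.positive⁻¹ δ {{posδ}}))
      δ≤xN , xN<δ = p N ℕ.≤-refl
  in ℚ.<-irrefl (≡.cong ∣_∣ (ℚ.+-identityʳ (seq x N))) (ℚ.<-≤-trans xN<δ δ≤xN)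

-- A term of size at least `ε` past the Cauchy index for `½ ε` would keep all later terms at least
-- `½ ε` away from 0. So being 0 is the negation of `Apart0`, which makes it stable.
¬apart⇒≈0 : ∀ {x} → ¬ Apart0 (seq x) → x ≈ℝ fromℕ 0
¬apart⇒≈0 {x} ¬apart = mk≈ λ ε 0<ε →
  let N , close = cauchy x (½ ℚ.* ε) (½ε>0 0<ε)
  in N , λ i N≤i → ≡.subst (λ a → ∣ a ∣ ℚ.< ε) (≡.sym (ℚ.+-identityʳ (seq x i)))
    (ℚ.≰⇒> λ ε≤xᵢ → ¬apart (½ ℚ.* ε , ℚ.positive (½ε>0 0<ε) , N , λ j N≤j →
      ℚ.≮⇒≥ λ xⱼ<½ε → ℚ.<-irrefl (≡.sym (½ε+½ε≡ε ε)) (ℚ.≤-<-trans ε≤xᵢ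
        (ℚ.<-trans (∣a∣<∣b∣+ε (seq x i) (seq x j) (close i j N≤i N≤j)) (ℚ.+-monoˡ-< (½ ℚ.* ε) xⱼ<½ε)))))

-- The reciprocal is 0 where it is not defined, which happens only at finitely
-- many places of a sequence apart from 0.
reciprocal : ℚ → ℚ
reciprocal q with q ℚ.≟ 0ℚ
... | yes _  = 0ℚ
... | no q≢0 = ℚ.1/_ q {{ℚ.≢-nonZero q≢0}}

reciprocal-inverse : ∀ {q} → q ≢ 0ℚ → reciprocal q ℚ.* q ≡ 1ℚ
reciprocal-inverse {q} q≢0 with q ℚ.≟ 0ℚ
... | yes q≡0 = contradiction q≡0 q≢0
... | no q≢0  = ℚ.*-inverseˡ q {{ℚ.≢-nonZero q≢0}}

positive≤∣q∣⇒≢0 : ∀ {δ q} → Positive δ → δ ℚ.≤ ∣ q ∣ → q ≢ 0ℚ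
positive≤∣q∣⇒≢0 {δ} posδ δ≤0 ≡.refl = ℚ.<-irrefl ≡.refl (ℚ.<-≤-trans (ℚ.positive⁻¹ δ {{posδ}}) δ≤0)

apart⇒invertible : ∀ {x} → Apart0 (seq x) → ∃[ y ] y *ℝ x ≈ℝ fromℕ 1
apart⇒invertible {x} (δ , posδ , N , δ≤x) =
  mkℝ (reciprocal ∘ seq x) y-cauchy ,
  mk≈ λ ε 0<ε → N , λ i N≤i → ≡.subst (ℚ._< ε) (≡.sym (≡.cong (λ a → ∣ a ℚ.- 1ℚ ∣) (inverse i N≤i))) 0<ε
  where
  instance
    _ = posδ
    _ = ℚ.pos*pos⇒pos δ δ
    _ = ℚ.pos⇒nonNeg δ
    _ = ℚ.pos⇒nonNeg (δ ℚ.* δ)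
  inverse : ∀ i → N ℕ.≤ i → reciprocal (seq x i) ℚ.* seq x i ≡ 1ℚ
  inverse i N≤i = reciprocal-inverse (positive≤∣q∣⇒≢0 posδ (δ≤x i N≤i))

  reciprocal-difference : ∀ a b c d → a ℚ.* c ≡ 1ℚ → b ℚ.* d ≡ 1ℚ → (c ℚ.* d) ℚ.* (a ℚ.- b) ≡ d ℚ.- c
  reciprocal-difference a b c d ac≡1 bd≡1 = ≡.trans
    (rearrange a b c d)
    (≡.trans (≡.cong₂ (λ p q → p ℚ.* d ℚ.- q ℚ.* c) ac≡1 bd≡1)
      (≡.cong₂ ℚ._-_ (ℚ.*-identityˡ d) (ℚ.*-identityˡ c)))
    where
    open +-*-Solver
    rearrange : ∀ a b c d → (c ℚ.* d) ℚ.* (a ℚ.- b) ≡ (a ℚ.* c) ℚ.* d ℚ.- (b ℚ.* d) ℚ.* c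
    rearrange = solve 4 (λ a b c d → (c :* d) :* (a :- b) := (a :* c) :* d :- (b :* d) :* c) ≡.refl

  y-cauchy : IsCauchy (reciprocal ∘ seq x)
  -- Since `1/a − 1/b = (b − a)/(a b)` and both denominators are at least `δ` in size, precision
  -- `δ² ε` for `x` gives `ε` for the reciprocals.
  y-cauchy ε 0<ε with cauchy x (δ ℚ.* δ ℚ.* ε)
    (≡.subst (ℚ._< δ ℚ.* δ ℚ.* ε) (ℚ.*-zeroʳ (δ ℚ.* δ)) (ℚ.*-monoʳ-<-pos (δ ℚ.* δ) 0<ε))
  ... | M , close = M ℕ.⊔ N , λ i j le le′ → ℚ.*-cancelˡ-<-nonNeg (δ ℚ.* δ)
      (bound i j (ℕ.m⊔n≤o⇒n≤o M N le) (ℕ.m⊔n≤o⇒n≤o M N le′)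
        (close j i (ℕ.m⊔n≤o⇒m≤o M N le′) (ℕ.m⊔n≤o⇒m≤o M N le)))
    where
    open ℚ.≤-Reasoning
    bound : ∀ i j → N ℕ.≤ i → N ℕ.≤ j → ∣ seq x j ℚ.- seq x i ∣ ℚ.< δ ℚ.* δ ℚ.* ε →
      δ ℚ.* δ ℚ.* ∣ reciprocal (seq x i) ℚ.- reciprocal (seq x j) ∣ ℚ.< δ ℚ.* δ ℚ.* ε
    bound i j N≤i N≤j xⱼ-xᵢ<δδε = begin-strict
      δ ℚ.* δ ℚ.* ∣ y ∣
        ≤⟨ ℚ.*-monoʳ-≤-nonNeg ∣ y ∣ {{ℚ.∣-∣-nonNeg y}} (ℚ.≤-trans
             (ℚ.*-monoʳ-≤-nonNeg δ (δ≤x i N≤i))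
             (ℚ.*-monoˡ-≤-nonNeg ∣ seq x i ∣ {{ℚ.∣-∣-nonNeg (seq x i)}} (δ≤x j N≤j))) ⟩
      ∣ seq x i ∣ ℚ.* ∣ seq x j ∣ ℚ.* ∣ y ∣
        ≡⟨ ≡.cong (ℚ._* ∣ y ∣) (ℚ.∣p*q∣≡∣p∣*∣q∣ (seq x i) (seq x j)) ⟨
      ∣ seq x i ℚ.* seq x j ∣ ℚ.* ∣ y ∣
        ≡⟨ ℚ.∣p*q∣≡∣p∣*∣q∣ (seq x i ℚ.* seq x j) y ⟨
      ∣ seq x i ℚ.* seq x j ℚ.* y ∣
        ≡⟨ ≡.cong ∣_∣ (reciprocal-difference (reciprocal (seq x i)) (reciprocal (seq x j)) (seq x i) (seq x j)
             (inverse i N≤i) (inverse j N≤j)) ⟩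
      ∣ seq x j ℚ.- seq x i ∣
        <⟨ xⱼ-xᵢ<δδε ⟩
      δ ℚ.* δ ℚ.* ε ∎
      where
      y = reciprocal (seq x i) ℚ.- reciprocal (seq x j)

square+square-apart : ∀ x y → Apart0 (seq x) → Apart0 (seq (x *ℝ x +ℝ y *ℝ y))
square+square-apart x y (δ , posδ , δ≤x) = δ ℚ.* δ , ℚ.pos*pos⇒pos δ δ , eventually-map
  (λ i δ≤xᵢ → bound (seq x i) (seq y i) δ≤xᵢ) δ≤x
  where
  open ℚ.≤-Reasoning
  instance
    _ = posδ
    _ = ℚ.pos⇒nonNeg δ
  0≤p*p : ∀ p → 0ℚ ℚ.≤ p ℚ.* p
  0≤p*p p = ℚ.≤-trans (ℚ.0≤∣p∣ (p ℚ.* p)) (ℚ.≤-reflexive (∣p*p∣≡p*p p))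
    where
    ∣p*p∣≡p*p : ∀ p → ∣ p ℚ.* p ∣ ≡ p ℚ.* p
    ∣p*p∣≡p*p p with ℚ.∣p∣≡p∨∣p∣≡-p p
    ... | inj₁ eq = ≡.trans (ℚ.∣p*q∣≡∣p∣*∣q∣ p p) (≡.cong₂ ℚ._*_ eq eq)
    ... | inj₂ eq = ≡.trans (ℚ.∣p*q∣≡∣p∣*∣q∣ p p) (≡.trans (≡.cong₂ ℚ._*_ eq eq) (-p*-p≡p*p p))
      where
      open +-*-Solver
      -p*-p≡p*p : ∀ p → (ℚ.- p) ℚ.* (ℚ.- p) ≡ p ℚ.* p
      -p*-p≡p*p = solve 1 (λ p → (:- p) :* (:- p) := p :* p) ≡.refl
  bound : ∀ p q → δ ℚ.≤ ∣ p ∣ → δ ℚ.* δ ℚ.≤ ∣ p ℚ.* p ℚ.+ q ℚ.* q ∣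
  bound p q δ≤p = begin
    δ ℚ.* δ                  ≤⟨ ℚ.*-monoʳ-≤-nonNeg δ δ≤p ⟩
    ∣ p ∣ ℚ.* δ              ≤⟨ ℚ.*-monoˡ-≤-nonNeg ∣ p ∣ {{ℚ.∣-∣-nonNeg p}} δ≤p ⟩
    ∣ p ∣ ℚ.* ∣ p ∣          ≡⟨ ℚ.∣p*q∣≡∣p∣*∣q∣ p p ⟨
    ∣ p ℚ.* p ∣              ≡⟨ ℚ.0≤p⇒∣p∣≡p (0≤p*p p) ⟩
    p ℚ.* p                  ≡⟨ ℚ.+-identityʳ (p ℚ.* p) ⟨
    p ℚ.* p ℚ.+ 0ℚ           ≤⟨ ℚ.+-monoʳ-≤ (p ℚ.* p) (0≤p*p q) ⟩
    p ℚ.* p ℚ.+ q ℚ.* q      ≡⟨ ℚ.0≤p⇒∣p∣≡p (ℚ.+-mono-≤ (0≤p*p p) (0≤p*p q)) ⟨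
    ∣ p ℚ.* p ℚ.+ q ℚ.* q ∣  ∎

-- The fields of ℂ-rawRing as definitions of their own: as renamed projections
-- they are not identified syntactically, and conversion unfolds Cauchy proofs.
infixl 6 _+ℂ_
infixl 7 _*ℂ_
infix  8 -ℂ_

_+ℂ_ _*ℂ_ : ℂ → ℂ → ℂ
z +ℂ w = (re z +ℝ re w) +i (im z +ℝ im w)
z *ℂ w = (re z *ℝ re w +ℝ -ℝ (im z *ℝ im w)) +i (re z *ℝ im w +ℝ im z *ℝ re w)

-ℂ_ : ℂ → ℂ
-ℂ z = (-ℝ re z) +i (-ℝ im z)

0ℂ 1ℂ : ℂ
0ℂ = fromℕ 0 +i fromℕ 0
1ℂ = fromℕ 1 +i fromℕ 0

-- The operations act termwise on sequences, so ring identities over ℚ carry over to ℂ term by term.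
≡⇒≈ℂ : ∀ {z w} → (∀ i → seq (re z) i ≡ seq (re w) i) → (∀ i → seq (im z) i ≡ seq (im w) i) → z ≈ℂ w
≡⇒≈ℂ re≡ im≡ = ≡⇒≈ℝ re≡ ,ℂ ≡⇒≈ℝ im≡

≈ℂ-isEquivalence : IsEquivalence _≈ℂ_
≈ℂ-isEquivalence = record
  { refl  = ≡⇒≈ℂ (λ _ → ≡.refl) (λ _ → ≡.refl)
  ; sym   = λ (r ,ℂ i) → ≈ℝ-sym r ,ℂ ≈ℝ-sym i
  ; trans = λ (r ,ℂ i) (r′ ,ℂ i′) → ≈ℝ-trans r r′ ,ℂ ≈ℝ-trans i i′
  }

module _ {a ℓ} {A : Set a} (_≈_ : A → A → Set ℓ) (isEquivalence : IsEquivalence _≈_)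
  (_+_ _*_ : A → A → A) (-_ : A → A) (0# 1# : A)
  (+-cong : ∀ {x y u v} → x ≈ y → u ≈ v → (x + u) ≈ (y + v))
  (+-assoc : ∀ x y z → ((x + y) + z) ≈ (x + (y + z)))
  (+-comm : ∀ x y → (x + y) ≈ (y + x))
  (+-identityˡ : ∀ x → (0# + x) ≈ x)
  (-‿cong : ∀ {x y} → x ≈ y → (- x) ≈ (- y))
  (-‿inverseˡ : ∀ x → ((- x) + x) ≈ 0#)
  (*-cong : ∀ {x y u v} → x ≈ y → u ≈ v → (x * u) ≈ (y * v))
  (*-assoc : ∀ x y z → ((x * y) * z) ≈ (x * (y * z)))
  (*-comm : ∀ x y → (x * y) ≈ (y * x))
  (*-identityˡ : ∀ x → (1# * x) ≈ x)
  (*-distribˡ-+ : ∀ x y z → (x * (y + z)) ≈ ((x * y) + (x * z)))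
  where

  private
    setoid : Setoid a ℓ
    setoid = record { isEquivalence = isEquivalence }

  open Consequences setoid

  commutativeRing : CommutativeRing a ℓ
  commutativeRing = record
    { isCommutativeRing = record
      { isRing = record
        { +-isAbelianGroup = record
          { isGroup = record
            { isMonoid = record
              { isSemigroup = record
                { isMagma = record { isEquivalence = isEquivalence ; ∙-cong = +-cong }
                ; assoc = +-assoc
                }
              ; identity = comm∧idˡ⇒id +-comm +-identityˡ
              }
            ; inverse = comm∧invˡ⇒inv +-comm -‿inverseˡ
            ; ⁻¹-cong = -‿cong
            }
          ; comm = +-comm
          }
        ; *-cong = *-cong
        ; *-assoc = *-assoc
        ; *-identity = comm∧idˡ⇒id *-comm *-identityˡ
        ; distrib = comm∧distrˡ⇒distr +-cong *-comm *-distribˡ-+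
        }
      ; *-comm = *-comm
      }
    }

module ℂ-laws where
  open +-*-Solver

  *ℂ-cong : ∀ {x y u v} → x ≈ℂ y → u ≈ℂ v → x *ℂ u ≈ℂ y *ℂ v
  *ℂ-cong {x} {y} {u} {v} (r ,ℂ i) (r′ ,ℂ i′) =
    +ℝ-cong (re x *ℝ re u) (re y *ℝ re v) (-ℝ (im x *ℝ im u)) (-ℝ (im y *ℝ im v))
      (*ℝ-cong (re x) (re y) (re u) (re v) r r′)
      (-ℝ-cong (im x *ℝ im u) (im y *ℝ im v) (*ℝ-cong (im x) (im y) (im u) (im v) i i′)) ,ℂ
    +ℝ-cong (re x *ℝ im u) (re y *ℝ im v) (im x *ℝ re u) (im y *ℝ re v)
      (*ℝ-cong (re x) (re y) (im u) (im v) r i′)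
      (*ℝ-cong (im x) (im y) (re u) (re v) i r′)

  *ℂ-assoc : ∀ x y z → (x *ℂ y) *ℂ z ≈ℂ x *ℂ (y *ℂ z)
  *ℂ-assoc x y z = ≡⇒≈ℂ
    (λ i → reals (seq (re x) i) (seq (im x) i) (seq (re y) i) (seq (im y) i) (seq (re z) i) (seq (im z) i))
    (λ i → imaginaries (seq (re x) i) (seq (im x) i) (seq (re y) i) (seq (im y) i) (seq (re z) i) (seq (im z) i))
    where
    reals : ∀ a b c d e f →
      (a ℚ.* c ℚ.- (b ℚ.* d)) ℚ.* e ℚ.- ((a ℚ.* d ℚ.+ b ℚ.* c) ℚ.* f) ≡
      a ℚ.* (c ℚ.* e ℚ.- (d ℚ.* f)) ℚ.- (b ℚ.* (c ℚ.* f ℚ.+ d ℚ.* e))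
    reals = solve 6 (λ a b c d e f → (a :* c :+ :- (b :* d)) :* e :+ :- ((a :* d :+ b :* c) :* f) :=
      a :* (c :* e :+ :- (d :* f)) :+ :- (b :* (c :* f :+ d :* e))) ≡.refl
    imaginaries : ∀ a b c d e f →
      (a ℚ.* c ℚ.- (b ℚ.* d)) ℚ.* f ℚ.+ (a ℚ.* d ℚ.+ b ℚ.* c) ℚ.* e ≡
      a ℚ.* (c ℚ.* f ℚ.+ d ℚ.* e) ℚ.+ b ℚ.* (c ℚ.* e ℚ.- (d ℚ.* f))
    imaginaries = solve 6 (λ a b c d e f → (a :* c :+ :- (b :* d)) :* f :+ (a :* d :+ b :* c) :* e :=
      a :* (c :* f :+ d :* e) :+ b :* (c :* e :+ :- (d :* f))) ≡.refl

  *ℂ-comm : ∀ x y → x *ℂ y ≈ℂ y *ℂ x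
  *ℂ-comm x y = ≡⇒≈ℂ
    (λ i → reals (seq (re x) i) (seq (im x) i) (seq (re y) i) (seq (im y) i))
    (λ i → imaginaries (seq (re x) i) (seq (im x) i) (seq (re y) i) (seq (im y) i))
    where
    reals : ∀ a b c d → a ℚ.* c ℚ.- (b ℚ.* d) ≡ c ℚ.* a ℚ.- (d ℚ.* b)
    reals = solve 4 (λ a b c d → a :* c :+ :- (b :* d) := c :* a :+ :- (d :* b)) ≡.refl
    imaginaries : ∀ a b c d → a ℚ.* d ℚ.+ b ℚ.* c ≡ c ℚ.* b ℚ.+ d ℚ.* a
    imaginaries = solve 4 (λ a b c d → a :* d :+ b :* c := c :* b :+ d :* a) ≡.refl

  *ℂ-identityˡ : ∀ x → 1ℂ *ℂ x ≈ℂ x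
  *ℂ-identityˡ x = ≡⇒≈ℂ
    (λ i → reals (seq (re x) i) (seq (im x) i)) (λ i → imaginaries (seq (re x) i) (seq (im x) i))
    where
    reals : ∀ a b → 1ℚ ℚ.* a ℚ.- (0ℚ ℚ.* b) ≡ a
    reals = solve 2 (λ a b → con 1ℚ :* a :+ :- (con 0ℚ :* b) := a) ≡.refl
    imaginaries : ∀ a b → 1ℚ ℚ.* b ℚ.+ 0ℚ ℚ.* a ≡ b
    imaginaries = solve 2 (λ a b → con 1ℚ :* b :+ con 0ℚ :* a := b) ≡.refl

  *ℂ-distribˡ-+ℂ : ∀ x y z → x *ℂ (y +ℂ z) ≈ℂ (x *ℂ y) +ℂ (x *ℂ z)
  *ℂ-distribˡ-+ℂ x y z = ≡⇒≈ℂ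
    (λ i → reals (seq (re x) i) (seq (im x) i) (seq (re y) i) (seq (im y) i) (seq (re z) i) (seq (im z) i))
    (λ i → imaginaries (seq (re x) i) (seq (im x) i) (seq (re y) i) (seq (im y) i) (seq (re z) i) (seq (im z) i))
    where
    reals : ∀ a b c d e f → a ℚ.* (c ℚ.+ e) ℚ.- (b ℚ.* (d ℚ.+ f)) ≡ (a ℚ.* c ℚ.- (b ℚ.* d)) ℚ.+ (a ℚ.* e ℚ.- (b ℚ.* f))
    reals = solve 6 (λ a b c d e f → a :* (c :+ e) :+ :- (b :* (d :+ f)) :=
      (a :* c :+ :- (b :* d)) :+ (a :* e :+ :- (b :* f))) ≡.refl
    imaginaries : ∀ a b c d e f → a ℚ.* (d ℚ.+ f) ℚ.+ b ℚ.* (c ℚ.+ e) ≡ (a ℚ.* d ℚ.+ b ℚ.* c) ℚ.+ (a ℚ.* f ℚ.+ b ℚ.* e)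
    imaginaries = solve 6 (λ a b c d e f → a :* (d :+ f) :+ b :* (c :+ e) :=
      (a :* d :+ b :* c) :+ (a :* f :+ b :* e)) ≡.refl

  +ℂ-cong : ∀ {x y u v} → x ≈ℂ y → u ≈ℂ v → x +ℂ u ≈ℂ y +ℂ v
  +ℂ-cong {x} {y} {u} {v} (r ,ℂ i) (r′ ,ℂ i′) =
    +ℝ-cong (re x) (re y) (re u) (re v) r r′ ,ℂ +ℝ-cong (im x) (im y) (im u) (im v) i i′

  -ℂ-cong : ∀ {x y} → x ≈ℂ y → -ℂ x ≈ℂ -ℂ y
  -ℂ-cong {x} {y} (r ,ℂ i) = -ℝ-cong (re x) (re y) r ,ℂ -ℝ-cong (im x) (im y) i

  +ℂ-assoc : ∀ x y z → (x +ℂ y) +ℂ z ≈ℂ x +ℂ (y +ℂ z)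
  +ℂ-assoc x y z = ≡⇒≈ℂ
    (λ i → ℚ.+-assoc (seq (re x) i) (seq (re y) i) (seq (re z) i))
    (λ i → ℚ.+-assoc (seq (im x) i) (seq (im y) i) (seq (im z) i))

  +ℂ-comm : ∀ x y → x +ℂ y ≈ℂ y +ℂ x
  +ℂ-comm x y = ≡⇒≈ℂ
    (λ i → ℚ.+-comm (seq (re x) i) (seq (re y) i)) (λ i → ℚ.+-comm (seq (im x) i) (seq (im y) i))

  +ℂ-identityˡ : ∀ x → 0ℂ +ℂ x ≈ℂ x
  +ℂ-identityˡ x =
    ≡⇒≈ℂ (λ i → ℚ.+-identityˡ (seq (re x) i)) (λ i → ℚ.+-identityˡ (seq (im x) i))

  -ℂ-inverseˡ : ∀ x → (-ℂ x) +ℂ x ≈ℂ 0ℂ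
  -ℂ-inverseˡ x =
    ≡⇒≈ℂ (λ i → ℚ.+-inverseˡ (seq (re x) i)) (λ i → ℚ.+-inverseˡ (seq (im x) i))

ℂ-commutativeRing : CommutativeRing 0ℓ 0ℓ
ℂ-commutativeRing = commutativeRing _≈ℂ_ ≈ℂ-isEquivalence _+ℂ_ _*ℂ_ -ℂ_ 0ℂ 1ℂ
  +ℂ-cong +ℂ-assoc +ℂ-comm +ℂ-identityˡ -ℂ-cong -ℂ-inverseˡ
  *ℂ-cong *ℂ-assoc *ℂ-comm *ℂ-identityˡ *ℂ-distribˡ-+ℂ
  where open ℂ-laws

ℂ-≈0-stable : ∀ z → ¬ ¬ (z ≈ℂ 0ℂ) → z ≈ℂ 0ℂ
ℂ-≈0-stable z ¬¬z≈0 =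
  ¬apart⇒≈0 (λ apart → ¬¬z≈0 λ (re≈0 ,ℂ _) → apart⇒≉0 apart re≈0) ,ℂ
  ¬apart⇒≈0 (λ apart → ¬¬z≈0 λ (_ ,ℂ im≈0) → apart⇒≉0 apart im≈0)

-- The inverse is the conjugate divided by the squared norm. The imaginary part of the product
-- cancels termwise; the real part is only `≈ℝ` to 1.
norm-apart⇒unit : ∀ z → Apart0 (seq (re z *ℝ re z +ℝ im z *ℝ im z)) → ∃[ w ] w *ℂ z ≈ℂ 1ℂ
norm-apart⇒unit z apart =
  let y , y*N≈1 = apart⇒invertible {re z *ℝ re z +ℝ im z *ℝ im z} apart
  in (y *ℝ re z) +i (-ℝ (y *ℝ im z)) ,
     (≈ℝ-trans (≡⇒≈ℝ λ i → reals (seq y i) (seq (re z) i) (seq (im z) i)) y*N≈1 ,ℂ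
      ≡⇒≈ℝ λ i → imaginaries (seq y i) (seq (re z) i) (seq (im z) i))
  where
  open +-*-Solver
  reals : ∀ y a b → (y ℚ.* a) ℚ.* a ℚ.- ((ℚ.- (y ℚ.* b)) ℚ.* b) ≡ y ℚ.* (a ℚ.* a ℚ.+ b ℚ.* b)
  reals = solve 3 (λ y a b → (y :* a) :* a :+ :- ((:- (y :* b)) :* b) := y :* (a :* a :+ b :* b)) ≡.refl
  imaginaries : ∀ y a b → (y ℚ.* a) ℚ.* b ℚ.+ (ℚ.- (y ℚ.* b)) ℚ.* a ≡ 0ℚ
  imaginaries = solve 3 (λ y a b → (y :* a) :* b :+ (:- (y :* b)) :* a := con 0ℚ) ≡.refl

ℂ-≈0-or-unit : ∀ z → ¬ ¬ (z ≈ℂ 0ℂ ⊎ ∃[ w ] w *ℂ z ≈ℂ 1ℂ)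
-- A real or imaginary part apart from 0 would make the norm apart and `z` a unit; with neither
-- apart, both are 0.
ℂ-≈0-or-unit z ¬either = ¬either (inj₁ (¬apart⇒≈0 ¬re-apart ,ℂ ¬apart⇒≈0 ¬im-apart))
  where
  ¬re-apart : ¬ Apart0 (seq (re z))
  ¬re-apart apart = ¬either (inj₂ (norm-apart⇒unit z (square+square-apart (re z) (im z) apart)))
  ¬im-apart : ¬ Apart0 (seq (im z))
  ¬im-apart apart = ¬either (inj₂ (norm-apart⇒unit z
    (let δ , posδ , δ≤ = square+square-apart (im z) (re z) apart
     in δ , posδ , eventually-map (λ i → ≡.subst (λ a → δ ℚ.≤ ∣ a ∣)
          (ℚ.+-comm (seq (im z) i ℚ.* seq (im z) i) (seq (re z) i ℚ.* seq (re z) i))) δ≤)))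

ℂ-1≉0 : ¬ (1ℂ ≈ℂ 0ℂ)
ℂ-1≉0 (1≈0 ,ℂ _) = apart⇒≉0 {fromℕ 1} (1ℚ , _ , 0 , λ _ _ → ℚ.≤-refl) 1≈0

ℝ-x+x≈0⇒x≈0 : ∀ x → x +ℝ x ≈ℝ fromℕ 0 → x ≈ℝ fromℕ 0
ℝ-x+x≈0⇒x≈0 x (mk≈ 2x≈0) = mk≈ (null-cong (λ i → halve (seq x i))
  (bounded-*-null {λ _ → ½} (½ , _ , 0 , λ _ _ → ℚ.≤-refl) 2x≈0))
  where
  open +-*-Solver
  halve : ∀ a → ½ ℚ.* ((a ℚ.+ a) ℚ.- 0ℚ) ≡ a ℚ.- 0ℚ
  halve = solve 1 (λ a → con ½ :* ((a :+ a) :- con 0ℚ) := a :- con 0ℚ) ≡.refl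

ℂ-x+x≈0⇒x≈0 : ∀ z → z +ℂ z ≈ℂ 0ℂ → z ≈ℂ 0ℂ
ℂ-x+x≈0⇒x≈0 z (re≈0 ,ℂ im≈0) = ℝ-x+x≈0⇒x≈0 (re z) re≈0 ,ℂ ℝ-x+x≈0⇒x≈0 (im z) im≈0

ℂ-isClassicalField : IsClassicalField ℂ-commutativeRing
ℂ-isClassicalField = record
  { ≈0-stable  = ℂ-≈0-stable
  ; ≈0-or-unit = ℂ-≈0-or-unit
  ; 1≉0        = ℂ-1≉0
  ; x+x≈0⇒x≈0  = ℂ-x+x≈0⇒x≈0
  }

ℂ-rankBound : RankBound ℂ-rawRing
ℂ-rankBound = LinearAlgebra.rankBound ℂ-commutativeRing ℂ-isClassicalField

-- Logarithms

<2^[1+⌊log₂⌋] : ∀ m → m ℕ.< 2 ℕ.^ suc ⌊log₂ m ⌋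
<2^[1+⌊log₂⌋] m = ℕ.≰⇒> λ le → ℕ.1+n≰n
  (≡.subst (ℕ._≤ ⌊log₂ m ⌋) (⌊log₂[2^n]⌋≡n (suc ⌊log₂ m ⌋)) (⌊log₂⌋-mono-≤ le))

2^-cancel-≤ : ∀ {a b} → 2 ℕ.^ a ℕ.≤ 2 ℕ.^ b → a ℕ.≤ b
2^-cancel-≤ {a} {b} 2^a≤2^b = ≡.subst₂ ℕ._≤_ (⌊log₂[2^n]⌋≡n a) (⌊log₂[2^n]⌋≡n b) (⌊log₂⌋-mono-≤ 2^a≤2^b)

^-distribʳ-* : ∀ m n o → (n ℕ.* o) ℕ.^ m ≡ n ℕ.^ m ℕ.* o ℕ.^ m
^-distribʳ-* zero    n o = ≡.refl
^-distribʳ-* (suc m) n o = ≡.trans (≡.cong (n ℕ.* o ℕ.*_) (^-distribʳ-* m n o))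
  (ℕ.[m*n]*[o*p]≡[m*o]*[n*p] n o (n ℕ.^ m) (o ℕ.^ m))

-- The `m`-th power of the hypothesis, with `nᵐ` rounded up to a power of 2. The rounding occurs
-- twice because the base contains `n²`, and the outer power `n` turns it into the error `2 n`,
-- which does not grow with `m`.
exponent-bound : ∀ n s m → 2 ℕ.^ s ℕ.≤ (2 ℕ.* (n ℕ.* n)) ℕ.^ n →
  s ℕ.* m ℕ.≤ (2 ℕ.* ⌊log₂ (n ℕ.^ m) ⌋ ℕ.+ m) ℕ.* n ℕ.+ 2 ℕ.* n
exponent-bound n s m 2^s≤ = 2^-cancel-≤ (begin
  2 ℕ.^ (s ℕ.* m)                                    ≡⟨ ℕ.^-*-assoc 2 s m ⟨
  (2 ℕ.^ s) ℕ.^ m                                    ≤⟨ ℕ.^-monoˡ-≤ m 2^s≤ ⟩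
  ((2 ℕ.* (n ℕ.* n)) ℕ.^ n) ℕ.^ m                    ≡⟨ ℕ.^-*-assoc (2 ℕ.* (n ℕ.* n)) n m ⟩
  (2 ℕ.* (n ℕ.* n)) ℕ.^ (n ℕ.* m)                    ≡⟨ ≡.cong ((2 ℕ.* (n ℕ.* n)) ℕ.^_) (ℕ.*-comm n m) ⟩
  (2 ℕ.* (n ℕ.* n)) ℕ.^ (m ℕ.* n)                    ≡⟨ ℕ.^-*-assoc (2 ℕ.* (n ℕ.* n)) m n ⟨
  ((2 ℕ.* (n ℕ.* n)) ℕ.^ m) ℕ.^ n                    ≤⟨ ℕ.^-monoˡ-≤ n base-bound ⟩
  (2 ℕ.^ (m ℕ.+ (suc l ℕ.+ suc l))) ℕ.^ n            ≡⟨ ℕ.^-*-assoc 2 (m ℕ.+ (suc l ℕ.+ suc l)) n ⟩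
  2 ℕ.^ ((m ℕ.+ (suc l ℕ.+ suc l)) ℕ.* n)            ≡⟨ ≡.cong (2 ℕ.^_) (rearrange m l n) ⟩
  2 ℕ.^ ((2 ℕ.* l ℕ.+ m) ℕ.* n ℕ.+ 2 ℕ.* n)          ∎)
  where
  open ℕ.≤-Reasoning
  l = ⌊log₂ (n ℕ.^ m) ⌋
  n^m≤ : n ℕ.^ m ℕ.≤ 2 ℕ.^ suc l
  n^m≤ = ℕ.<⇒≤ (<2^[1+⌊log₂⌋] (n ℕ.^ m))
  base-bound : (2 ℕ.* (n ℕ.* n)) ℕ.^ m ℕ.≤ 2 ℕ.^ (m ℕ.+ (suc l ℕ.+ suc l))
  base-bound = begin
    (2 ℕ.* (n ℕ.* n)) ℕ.^ m                          ≡⟨ ^-distribʳ-* m 2 (n ℕ.* n) ⟩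
    2 ℕ.^ m ℕ.* (n ℕ.* n) ℕ.^ m                      ≡⟨ ≡.cong (2 ℕ.^ m ℕ.*_) (^-distribʳ-* m n n) ⟩
    2 ℕ.^ m ℕ.* (n ℕ.^ m ℕ.* n ℕ.^ m)                ≤⟨ ℕ.*-monoʳ-≤ (2 ℕ.^ m) (ℕ.*-mono-≤ n^m≤ n^m≤) ⟩
    2 ℕ.^ m ℕ.* (2 ℕ.^ suc l ℕ.* 2 ℕ.^ suc l)        ≡⟨ ≡.cong (2 ℕ.^ m ℕ.*_) (ℕ.^-distribˡ-+-* 2 (suc l) (suc l)) ⟨
    2 ℕ.^ m ℕ.* 2 ℕ.^ (suc l ℕ.+ suc l)              ≡⟨ ℕ.^-distribˡ-+-* 2 m (suc l ℕ.+ suc l) ⟨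
    2 ℕ.^ (m ℕ.+ (suc l ℕ.+ suc l))                  ∎
  rearrange : ∀ m l n → (m ℕ.+ (suc l ℕ.+ suc l)) ℕ.* n ≡ (2 ℕ.* l ℕ.+ m) ℕ.* n ℕ.+ 2 ℕ.* n
  rearrange = solve 3 (λ m l n → (m :+ ((con 1 :+ l) :+ (con 1 :+ l))) :* n :=
    (con 2 :* l :+ m) :* n :+ con 2 :* n) ≡.refl
    where open ℕ-Solver

fromNat : ℕ → ℚ
fromNat k = + k ℚ./ 1

module _ where
  open ℚᵘ.≃-Reasoning

  fromNat-+ : ∀ a b → fromNat (a ℕ.+ b) ≡ fromNat a ℚ.+ fromNat b
  fromNat-+ a b = ℚ.toℚᵘ-injective (begin
    ℚ.toℚᵘ (fromNat (a ℕ.+ b))                       ≈⟨ ℚ.toℚᵘ-fromℚᵘ (mkℚᵘ (+ (a ℕ.+ b)) 0) ⟩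
    mkℚᵘ (+ (a ℕ.+ b)) 0                             ≈⟨ ℚᵘ.*≡* (≡.cong (ℤ._* + 1) (≡.sym
                                                          (≡.cong₂ ℤ._+_ (ℤ.*-identityʳ (+ a)) (ℤ.*-identityʳ (+ b))))) ⟩
    mkℚᵘ (+ a) 0 ℚᵘ.+ mkℚᵘ (+ b) 0                   ≈⟨ ℚᵘ.+-cong (ℚ.toℚᵘ-fromℚᵘ (mkℚᵘ (+ a) 0)) (ℚ.toℚᵘ-fromℚᵘ (mkℚᵘ (+ b) 0)) ⟨
    ℚ.toℚᵘ (fromNat a) ℚᵘ.+ ℚ.toℚᵘ (fromNat b)       ≈⟨ ℚ.toℚᵘ-homo-+ (fromNat a) (fromNat b) ⟨
    ℚ.toℚᵘ (fromNat a ℚ.+ fromNat b)                 ∎)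

  fromNat-* : ∀ a b → fromNat (a ℕ.* b) ≡ fromNat a ℚ.* fromNat b
  fromNat-* a b = ℚ.toℚᵘ-injective (begin
    ℚ.toℚᵘ (fromNat (a ℕ.* b))                       ≈⟨ ℚ.toℚᵘ-fromℚᵘ (mkℚᵘ (+ (a ℕ.* b)) 0) ⟩
    mkℚᵘ (+ (a ℕ.* b)) 0                             ≈⟨ ℚᵘ.*≡* (≡.cong (ℤ._* + 1) (ℤ.pos-* a b)) ⟩
    mkℚᵘ (+ a) 0 ℚᵘ.* mkℚᵘ (+ b) 0                   ≈⟨ ℚᵘ.*-cong (ℚ.toℚᵘ-fromℚᵘ (mkℚᵘ (+ a) 0)) (ℚ.toℚᵘ-fromℚᵘ (mkℚᵘ (+ b) 0)) ⟨
    ℚ.toℚᵘ (fromNat a) ℚᵘ.* ℚ.toℚᵘ (fromNat b)       ≈⟨ ℚ.toℚᵘ-homo-* (fromNat a) (fromNat b) ⟨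
    ℚ.toℚᵘ (fromNat a ℚ.* fromNat b)                 ∎)

  /-*-cancel : ∀ a b → (+ a ℚ./ suc b) ℚ.* fromNat (suc b) ≡ fromNat a
  /-*-cancel a b = ℚ.toℚᵘ-injective (begin
    ℚ.toℚᵘ ((+ a ℚ./ suc b) ℚ.* fromNat (suc b))     ≈⟨ ℚ.toℚᵘ-homo-* (+ a ℚ./ suc b) (fromNat (suc b)) ⟩
    ℚ.toℚᵘ (+ a ℚ./ suc b) ℚᵘ.* ℚ.toℚᵘ (fromNat (suc b))
                                                     ≈⟨ ℚᵘ.*-cong (ℚ.toℚᵘ-fromℚᵘ (mkℚᵘ (+ a) b)) (ℚ.toℚᵘ-fromℚᵘ (mkℚᵘ (+ suc b) 0)) ⟩
    mkℚᵘ (+ a) b ℚᵘ.* mkℚᵘ (+ suc b) 0               ≈⟨ ℚᵘ.*≡* (≡.trans (ℤ.*-identityʳ (+ a ℤ.* + suc b))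
                                                          (≡.cong (λ k → + a ℤ.* + suc k) (≡.sym (ℕ.*-identityʳ b)))) ⟩
    mkℚᵘ (+ a) 0                                     ≈⟨ ℚ.toℚᵘ-fromℚᵘ (mkℚᵘ (+ a) 0) ⟨
    ℚ.toℚᵘ (fromNat a)                               ∎)

fromNat-mono-≤ : ∀ {a b} → a ℕ.≤ b → fromNat a ℚ.≤ fromNat b
fromNat-mono-≤ {a} {b} a≤b = ℚ.toℚᵘ-cancel-≤
  (ℚᵘ.≤-respʳ-≃ (ℚᵘ.≃-sym (ℚ.toℚᵘ-fromℚᵘ (mkℚᵘ (+ b) 0)))
    (ℚᵘ.≤-respˡ-≃ (ℚᵘ.≃-sym (ℚ.toℚᵘ-fromℚᵘ (mkℚᵘ (+ a) 0)))
      (ℚᵘ.*≤* (ℤ.*-monoʳ-≤-nonNeg (+ 1) (ℤ.+≤+ a≤b)))))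

fromNat-mono-< : ∀ {a b} → a ℕ.< b → fromNat a ℚ.< fromNat b
fromNat-mono-< {a} {b} a<b = ℚ.toℚᵘ-cancel-<
  (ℚᵘ.<-respʳ-≃ (ℚᵘ.≃-sym (ℚ.toℚᵘ-fromℚᵘ (mkℚᵘ (+ b) 0)))
    (ℚᵘ.<-respˡ-≃ (ℚᵘ.≃-sym (ℚ.toℚᵘ-fromℚᵘ (mkℚᵘ (+ a) 0)))
      (ℚᵘ.*<* (ℤ.*-monoʳ-<-pos (+ 1) (ℤ.+<+ a<b)))))

archimedean : ∀ k ε → 0ℚ ℚ.< ε → ∃[ N ] ∀ m → N ℕ.≤ m → fromNat k ℚ.< ε ℚ.* fromNat m
archimedean k (ℚ.mkℚ (+ zero) d _) (ℚ.*<* (ℤ.+<+ ()))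
archimedean k (ℚ.mkℚ -[1+ _ ] d _) (ℚ.*<* ())
-- Here `ε = (p + 1)/(d + 1)`, so at the witness `ε` times it is `(p + 1)(k + 1) > k`.
archimedean k ε@(ℚ.mkℚ (+ suc p) d _) 0<ε = suc d ℕ.* suc k , λ m N≤m → begin-strict
  fromNat k                                <⟨ fromNat-mono-< (ℕ.n<1+n k) ⟩
  fromNat (suc k)                          ≤⟨ fromNat-mono-≤ (ℕ.m≤n*m (suc k) (suc p)) ⟩
  fromNat (suc p ℕ.* suc k)                ≡⟨ fromNat-* (suc p) (suc k) ⟩
  fromNat (suc p) ℚ.* fromNat (suc k)      ≡⟨ ≡.cong (ℚ._* fromNat (suc k)) (/-*-cancel (suc p) d) ⟨
  (+ suc p ℚ./ suc d) ℚ.* fromNat (suc d) ℚ.* fromNat (suc k)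
                                           ≡⟨ ≡.cong (λ q → q ℚ.* fromNat (suc d) ℚ.* fromNat (suc k)) (ℚ.↥p/↧p≡p ε) ⟩
  ε ℚ.* fromNat (suc d) ℚ.* fromNat (suc k)
                                           ≡⟨ ℚ.*-assoc ε (fromNat (suc d)) (fromNat (suc k)) ⟩
  ε ℚ.* (fromNat (suc d) ℚ.* fromNat (suc k))
                                           ≡⟨ ≡.cong (ε ℚ.*_) (fromNat-* (suc d) (suc k)) ⟨
  ε ℚ.* fromNat (suc d ℕ.* suc k)          ≤⟨ ℚ.*-monoˡ-≤-nonNeg ε (fromNat-mono-≤ N≤m) ⟩
  ε ℚ.* fromNat m                          ∎
  where open ℚ.≤-Reasoning

-- After multiplication by `suc i`, the denominator in the `i`-th term of `log₂-seq n`, this is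
-- `exponent-bound` with its error `2 n` absorbed by `ε`.
eventually-below-log-bound : ∀ n s → 2 ℕ.^ s ℕ.≤ (2 ℕ.* (n ℕ.* n)) ℕ.^ n →
  ∀ ε → 0ℚ ℚ.< ε → ∃[ N ] ∀ i → N ℕ.≤ i →
  fromNat s ℚ.< (fromNat 2 ℚ.* log₂-seq n i ℚ.+ fromNat 1) ℚ.* fromNat n ℚ.+ ε
eventually-below-log-bound n s 2^s≤ ε 0<ε =
  let N , archimedes = archimedean (2 ℕ.* n) ε 0<ε
  in N , λ i N≤i → ℚ.*-cancelʳ-<-nonNeg (fromNat (suc i)) {{ℚ.normalize-nonNeg (suc i) 1}}
    (bound i (archimedes (suc i) (ℕ.m≤n⇒m≤1+n N≤i)))
  where
  open ℚ.≤-Reasoning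
  rearrange : ∀ q n ε m → ((fromNat 2 ℚ.* q ℚ.+ fromNat 1) ℚ.* n ℚ.+ ε) ℚ.* m ≡
    (fromNat 2 ℚ.* (q ℚ.* m) ℚ.+ m) ℚ.* n ℚ.+ ε ℚ.* m
  rearrange = solve 4 (λ q n ε m → ((con (fromNat 2) :* q :+ con (fromNat 1)) :* n :+ ε) :* m :=
    (con (fromNat 2) :* (q :* m) :+ m) :* n :+ ε :* m) ≡.refl
    where open +-*-Solver
  bound : ∀ i → fromNat (2 ℕ.* n) ℚ.< ε ℚ.* fromNat (suc i) →
    fromNat s ℚ.* fromNat (suc i) ℚ.<
    ((fromNat 2 ℚ.* log₂-seq n i ℚ.+ fromNat 1) ℚ.* fromNat n ℚ.+ ε) ℚ.* fromNat (suc i)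
  bound i 2n<εm = begin-strict
    fromNat s ℚ.* fromNat m                                  ≡⟨ fromNat-* s m ⟨
    fromNat (s ℕ.* m)                                        ≤⟨ fromNat-mono-≤ (exponent-bound n s m 2^s≤) ⟩
    fromNat ((2 ℕ.* l ℕ.+ m) ℕ.* n ℕ.+ 2 ℕ.* n)              ≡⟨ fromNat-+ ((2 ℕ.* l ℕ.+ m) ℕ.* n) (2 ℕ.* n) ⟩
    fromNat ((2 ℕ.* l ℕ.+ m) ℕ.* n) ℚ.+ fromNat (2 ℕ.* n)    <⟨ ℚ.+-monoʳ-< (fromNat ((2 ℕ.* l ℕ.+ m) ℕ.* n)) 2n<εm ⟩
    fromNat ((2 ℕ.* l ℕ.+ m) ℕ.* n) ℚ.+ ε ℚ.* fromNat m      ≡⟨ ≡.cong (ℚ._+ ε ℚ.* fromNat m) (fromNat-* (2 ℕ.* l ℕ.+ m) n) ⟩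
    fromNat (2 ℕ.* l ℕ.+ m) ℚ.* fromNat n ℚ.+ ε ℚ.* fromNat m
      ≡⟨ ≡.cong (λ q → q ℚ.* fromNat n ℚ.+ ε ℚ.* fromNat m)
           (≡.trans (fromNat-+ (2 ℕ.* l) m) (≡.cong (ℚ._+ fromNat m)
             (≡.trans (fromNat-* 2 l) (≡.cong (fromNat 2 ℚ.*_) (≡.sym (/-*-cancel l i)))))) ⟩
    (fromNat 2 ℚ.* (log₂-seq n i ℚ.* fromNat m) ℚ.+ fromNat m) ℚ.* fromNat n ℚ.+ ε ℚ.* fromNat m
      ≡⟨ rearrange (log₂-seq n i) (fromNat n) ε (fromNat m) ⟨
    ((fromNat 2 ℚ.* log₂-seq n i ℚ.+ fromNat 1) ℚ.* fromNat n ℚ.+ ε) ℚ.* fromNat m ∎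
    where
    m = suc i
    l = ⌊log₂ (n ℕ.^ m) ⌋

-- The inequality between real numbers

open import Algebra.Definitions.RawMonoid +-0-rawMonoid using (sum)
open Matrices ℂ-rawRing

isRank-resp-≡ : ∀ {n r} {A B : Matrix n} → A ≡ B → IsRank A r → IsRank B r
isRank-resp-≡ ≡.refl isRank = isRank

^ᴹ-unaliased : ∀ {n} (A : Matrix n) m → A ^ᴹ m ≡ Matrices._^ᴹ_ ℂ-rawRing A m
^ᴹ-unaliased A m = ≡.refl

-- The two types are convertible, but the conversion checker does not identify
-- the powers syntactically and unfolds Cauchy proofs.
isRank-unaliased : ∀ {n k} (e : Vector (Matrix n) k) (rk : Fin k → ℕ) →
  (∀ i → IsRank (e i ^ᴹ n) (rk i)) →
  ∀ i → Matrices.IsRank ℂ-rawRing (Matrices._^ᴹ_ ℂ-rawRing (e i) n) (rk i)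
isRank-unaliased {n} e rk isRank i = isRank-resp-≡ (^ᴹ-unaliased (e i) n) (isRank i)

theorem3 : (n k : ℕ) .{{_ : NonZero n}} (e : Vector (Matrix n) k) → Anticommuting e →
    (rk : Fin k → ℕ) → (∀ i → IsRank (e i ^ᴹ n) (rk i)) →
    fromℕ (sum rk) ≤ℝ (fromℕ 2 *ℝ log₂ n +ℝ fromℕ 1) *ℝ fromℕ n
-- Constants are constant sequences and the real operations act termwise, so the terms of both sides
-- compute to those of the rational bound.
theorem3 n k e ee rk isRank = mk≤ (eventually-below-log-bound n (sum rk)
  (RankBound.2^∑rk≤ ℂ-rankBound n k e ee rk (isRank-unaliased e rk isRank)))
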